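{- Let $t\ge2$, $\zeta=e^{2\pi i/t}$, and let $\lambda=(\lambda_1,\lambda_2)$ be a partition with at most two parts. Then $$s_\lambda(1,\zeta,\dots,\zeta^{t-1},z,z^{ -1})=s_\lambda(z,z^{ -1})$$ (an equality of Laurent polynomials in $z$, sign included) if and only if either $\lambda$ is a $t$-core, i.e. $\lambda=\operatorname{core}_t(\lambda)$, or $$t\text{ is even and }\lambda=\Bigl(\lambda_2+\tfrac{3t}{2}-1,\ \lambda_2\Bigr)\text{ with }\tfrac t2\le\lambda_2\le t-1.$$ In the second case $\{d_1,d_2,d_3\}=\{3t,t,t\}$ as multisets and $\varepsilon_\lambda=+1$, while, with $j=\lambda_2-\tfrac t2$, $\operatorname{core}_t(\lambda)=\bigl(\tfrac t2-1+j,\,j\bigr)$ and the $t$-quotient of $\lambda$ has the single nonempty component $(2)$, in slot $j$.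
   Context: Let $N=t+2$; for $\lambda=(\lambda_1\ge\dots\ge\lambda_N\ge0)$ (padded with zeros) let $\beta_j=\lambda_j+N-j$ ($j$ is the column of $\beta_j$) and $\beta(\lambda)=\{\beta_1>\dots>\beta_N\}$. The $t$-quotient $(\lambda^{(0)},\dots,\lambda^{(t-1)})$ is computed from this $N$-element beta set: if the elements of $\beta(\lambda)$ congruent to $i$ modulo $t$ are $t\tilde a_1+i>\dots>t\tilde a_{n}+i$, then $\lambda^{(i)}=(\tilde a_1-n+1,\dots,\tilde a_n)$; $\operatorname{core}_t$ is the usual $t$-core. If no residue class modulo $t$ is missed by $\beta(\lambda)$, then either exactly two classes $r_A<r_B$ contain two elements (others one), and $A=\{a_1>a_2\}$, $B=\{b_1>b_2\}$ are the elements in classes $r_A,r_B$; or exactly one class $\{p>q>r\}$ contains three (others one), and $A=\{a_1>a_2\}=\{p,q\}$, $B=\{b_1>b_2\}=\{q,r\}$. Then $d_1=a_1-a_2$, $d_2=b_1-b_2$, $\tilde d_3=a_1+a_2-b_1-b_2$, $d_3=|\tilde d_3|$, and for $\tilde d_3\ne0$, $\varepsilon_\lambda=(-1)^{t+\binom{N+1}{2}}(-1)^{j_{A_1}+j_{B_1}+\operatorname{inv}(b_S)}\operatorname{sgn}(a_1-b_1)\operatorname{sgn}(\tilde d_3)$, where $j_{A_1},j_{B_1}$ are the columns of $a_1,b_1$, $S=\{1,\dots,N\}\setminus\{j_{A_1},j_{B_1}\}$, $b_S$ is the word of residues $\beta_j\bmod t\in\{0,\dots,t-1\}$, $j\in S$,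 in increasing order of $j$, and $\operatorname{inv}$ counts inversions. -}

module Defs where

open import Level using (Level)
open import Algebra.Apartness.Bundles using (HeytingField; HeytingCommutativeRing)
open import Algebra.Bundles using (CommutativeRing; Semiring)
open import Algebra.Bundles.Raw using (RawSemiring)
import Algebra.Definitions.RawMonoid as RawMonoidDefs
import Algebra.Definitions.RawSemiring as RawSemiringDefs
open import Data.Fin as Fin using (Fin; toℕ)
import Data.Fin.Properties as Fin
open import Data.Integer as ℤ using (ℤ; +_; -[1+_]; +0; +[1+_]; 0ℤ; 1ℤ; -1ℤ; _⊖_; ∣_∣)
open import Data.List using (List; []; _∷_; [_]; _++_; map; filter; foldr; length; concat;
  upTo; downFrom; allFin; cartesianProductWith)
open import Data.List.Relation.Binary.Prefix.Heterogeneous using (Prefix)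
open import Data.List.Relation.Binary.Prefix.Heterogeneous.Properties using (prefix?)
open import Data.List.Relation.Unary.All using (All; all?)
open import Data.List.Relation.Unary.Linked using (Linked; linked?)
open import Data.Nat using (ℕ; zero; suc; _+_; _*_; _∸_; _≤_; _<_; _≟_; _<?_; NonZero)
open import Data.Nat.Combinatorics using (_C_)
open import Data.Nat.Divisibility using (_∣_)
open import Data.Nat.DivMod using (_/_; _%_)
open import Data.Product using (_×_; _,_)
open import Data.Vec as Vec using (Vec; lookup)
open import Function using (flip)
open import Relation.Binary.PropositionalEquality using (_≡_; _≢_)
open import Relation.Nullary using (¬_; ¬?; yes; no)
open import Relation.Nullary.Decidable using (_×-dec_)
open import Relation.Unary using (Decidable)

private variable
  c ℓ ℓ₁ ℓ₂ : Level

------------------------------------------------------------------------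
-- Schur polynomials

-- A filling of a Young diagram by {0,…,n-1}, as the list of its rows.
Filling : ℕ → Set
Filling n = List (List (Fin n))

words : (n k : ℕ) → List (List (Fin n))
words n zero    = [ [] ]
words n (suc k) = cartesianProductWith _∷_ (allFin n) (words n k)

fillings : (n : ℕ) → List ℕ → List (Filling n)
fillings n []       = [ [] ]
fillings n (l ∷ ls) = cartesianProductWith _∷_ (words n l) (fillings n ls)

-- `Prefix Fin._>_ s r` says that row s is no longer than the row r above it
-- and that each of its entries is larger than the entry directly above.
Semistandard : ∀ {n} → Filling n → Set
Semistandard T = All (Linked Fin._≤_) T × Linked (flip (Prefix Fin._>_)) T

semistandard? : ∀ {n} → Decidable (Semistandard {n})
semistandard? T =
  all? (linked? Fin._≤?_) T ×-dec linked? (λ r s → prefix? (λ i j → j Fin.<? i) s r) T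

tableaux : (n : ℕ) → List ℕ → List (Filling n)
tableaux n shape = filter semistandard? (fillings n shape)

-- s_λ(x₁,…,xₙ) = Σ_T x^T over the semistandard tableaux T of shape λ.
schur : (R : RawSemiring c ℓ) → ∀ {n} →
        Vec (RawSemiring.Carrier R) n → List ℕ → RawSemiring.Carrier R
schur R {n} x shape = foldr _⊕_ 0# (map monomial (tableaux n shape))
  where
  open RawSemiring R renaming (_+_ to _⊕_; _*_ to _⊗_)
  monomial : Filling n → Carrier
  monomial T = foldr _⊗_ 1# (map (lookup x) (concat T))

------------------------------------------------------------------------
-- Laurent polynomials in one variable z

-- Finite formal sums Σ aᵢ z^{eᵢ}, with repeated exponents allowed; two of them
-- are equal when all their coefficients agree.
module Laurent (R : RawSemiring c ℓ) where
  open RawSemiring R renaming (_+_ to _⊕_; _*_ to _⊗_)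

  Laurent : Set c
  Laurent = List (Carrier × ℤ)

  coeff : Laurent → ℤ → Carrier
  coeff []            k = 0#
  coeff ((a , e) ∷ p) k with e ℤ.≟ k
  ... | yes _ = a ⊕ coeff p k
  ... | no  _ = coeff p k

  _≈ᴸ_ : Laurent → Laurent → Set ℓ
  p ≈ᴸ q = ∀ k → coeff p k ≈ coeff q k

  const : Carrier → Laurent
  const a = [ a , 0ℤ ]

  z z⁻¹ : Laurent
  z   = [ 1# , 1ℤ ]
  z⁻¹ = [ 1# , -1ℤ ]

  laurent : RawSemiring c ℓ
  laurent = record
    { Carrier = Laurent
    ; _≈_     = _≈ᴸ_
    ; _+_     = _++_
    ; _*_     = cartesianProductWith (λ (a , e) (b , f) → a ⊗ b , e ℤ.+ f)
    ; 0#      = []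
    ; 1#      = const 1#
    }

------------------------------------------------------------------------
-- Coefficient fields

fieldRaw : HeytingField c ℓ₁ ℓ₂ → RawSemiring c ℓ₁
fieldRaw K = Semiring.rawSemiring (CommutativeRing.semiring
  (HeytingCommutativeRing.commutativeRing (HeytingField.heytingCommutativeRing K)))

CharacteristicZero : HeytingField c ℓ₁ ℓ₂ → Set ℓ₁
CharacteristicZero K = ∀ n → ¬ (suc n ·ₙ 1# ≈ 0#)
  where
  open RawSemiring (fieldRaw K) using (_≈_; 0#; 1#; +-rawMonoid)
  open RawMonoidDefs +-rawMonoid using () renaming (_×_ to _·ₙ_)

PrimitiveRoot : (K : HeytingField c ℓ₁ ℓ₂) → ℕ → HeytingField.Carrier K → Set ℓ₁
PrimitiveRoot K t ζ = ζ ^ t ≈ 1# × (∀ k → 0 < k → k < t → ¬ (ζ ^ k ≈ 1#))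
  where
  open RawSemiring (fieldRaw K) using (_≈_; 1#)
  open RawSemiringDefs (fieldRaw K) using (_^_)

-- s_λ(1,ζ,…,ζ^{t-1},z,z⁻¹) = s_λ(z,z⁻¹) in K[z,z⁻¹].
SchurIdentity : (K : HeytingField c ℓ₁ ℓ₂) → ℕ → HeytingField.Carrier K → List ℕ → Set ℓ₁
SchurIdentity K t ζ shape =
  schur laurent (powers Vec.++ z Vec.∷ z⁻¹ Vec.∷ Vec.[]) shape
    ≈ᴸ schur laurent (z Vec.∷ z⁻¹ Vec.∷ Vec.[]) shape
  where
  open Laurent (fieldRaw K)
  open RawSemiringDefs (fieldRaw K) using (_^_)
  powers : Vec Laurent t
  powers = Vec.tabulate (λ i → const (ζ ^ toℕ i))

------------------------------------------------------------------------
-- Partitions, cores and quotients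

-- Partitions are weakly decreasing lists of parts, up to trailing zeros.
part : List ℕ → ℕ → ℕ
part []       _       = 0
part (x ∷ _)  zero    = x
part (_ ∷ xs) (suc i) = part xs i

infix 4 _≋_
_≋_ : List ℕ → List ℕ → Set
xs ≋ ys = ∀ i → part xs i ≡ part ys i

-- λ_j + N - j for j = 1,…,N, in this (decreasing) order; parts after the N-th
-- are ignored.
beta : ℕ → List ℕ → List ℕ
beta zero    _        = []
beta (suc n) []       = n ∷ beta n []
beta (suc n) (l ∷ ls) = l + n ∷ beta n ls

-- The partition with a given beta set, listed in decreasing order.
fromBeta : List ℕ → List ℕ
fromBeta []       = []
fromBeta (b ∷ bs) = b ∸ length bs ∷ fromBeta bs

module _ (t : ℕ) .{{_ : NonZero t}} where

  class : List ℕ → ℕ → List ℕ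
  class bs i = filter (λ b → b % t ≟ i) bs

  betaSet : List ℕ → List ℕ
  betaSet = beta (t + 2)

  quotient : List ℕ → ℕ → List ℕ
  quotient shape i = fromBeta (map (_/ t) (class (betaSet shape) i))

  -- The t-core by the abacus: in each residue class i, with nᵢ beads, the
  -- beads are pushed down to i, i + t, …, i + (nᵢ - 1)t, all below (t + 2)t.
  core : List ℕ → List ℕ
  core shape = fromBeta (filter (λ x → x / t <? length (class (betaSet shape) (x % t)))
                                (downFrom ((t + 2) * t)))

------------------------------------------------------------------------
-- The numbers d₁, d₂, d₃ and the sign

record Pairs : Set where
  constructor pairs
  field a₁ a₂ b₁ b₂ : ℕ

  d₁ d₂ d₃ : ℕ
  d̃₃ : ℤ
  d₁ = a₁ ∸ a₂
  d₂ = b₁ ∸ b₂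
  d̃₃ = (a₁ + a₂) ⊖ (b₁ + b₂)
  d₃ = ∣ d̃₃ ∣

-- A and B for a partition whose beta set misses no residue class; they are
-- uniquely determined by the partition.
data IsPairs (t : ℕ) .{{_ : NonZero t}} (shape : List ℕ) : Pairs → Set where
  twoDouble : ∀ {rA rB a₁ a₂ b₁ b₂} → rA < rB → rB < t →
    class t (betaSet t shape) rA ≡ a₁ ∷ a₂ ∷ [] →
    class t (betaSet t shape) rB ≡ b₁ ∷ b₂ ∷ [] →
    (∀ r → r < t → r ≢ rA → r ≢ rB → length (class t (betaSet t shape) r) ≡ 1) →
    IsPairs t shape (pairs a₁ a₂ b₁ b₂)
  oneTriple : ∀ {r₀ p q r} → r₀ < t →
    class t (betaSet t shape) r₀ ≡ p ∷ q ∷ r ∷ [] →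
    (∀ r → r < t → r ≢ r₀ → length (class t (betaSet t shape) r) ≡ 1) →
    IsPairs t shape (pairs p q q r)

-- 1-based position of the first occurrence.
column : ℕ → List ℕ → ℕ
column x []       = 1
column x (b ∷ bs) with x ≟ b
... | yes _ = 1
... | no  _ = suc (column x bs)

inversions : List ℕ → ℕ
inversions []       = 0
inversions (x ∷ xs) = length (filter (_<? x) xs) + inversions xs

sgn : ℤ → ℤ
sgn +0       = 0ℤ
sgn +[1+ _ ] = 1ℤ
sgn -[1+ _ ] = -1ℤ

-- The sign ε_λ, meaningful when d̃₃ ≠ 0. As beta numbers are distinct, dropping
-- the columns of a₁ and b₁ amounts to dropping the values a₁ and b₁.
ε : (t : ℕ) .{{_ : NonZero t}} → List ℕ → Pairs → ℤ
ε t shape P =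
  -1ℤ ℤ.^ (t + (N + 1) C 2)
    ℤ.* -1ℤ ℤ.^ (column a₁ β + column b₁ β + inversions bS)
    ℤ.* sgn (a₁ ⊖ b₁)
    ℤ.* sgn d̃₃
  where
  open Pairs P
  N : ℕ
  N = t + 2
  β bS : List ℕ
  β  = betaSet t shape
  bS = map (_% t) (filter (λ b → ¬? (b ≟ a₁) ×-dec ¬? (b ≟ b₁)) β)

-- The non-core partitions (λ₁,λ₂) of the classification.
Exceptional : (t λ₁ λ₂ : ℕ) → Set
Exceptional t λ₁ λ₂ =
  2 ∣ t × λ₁ ≡ λ₂ + (3 * t) / 2 ∸ 1 × t / 2 ≤ λ₂ × λ₂ ≤ t ∸ 1

{-# OPTIONS --safe #-}
-- For a two-rowed shape s_λ = h_{λ₁} h_{λ₂} − h_{λ₁+1} h_{λ₂−1}, and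
-- h_k(1,ζ,…,ζ^{t-1}) is 1 if t divides k and 0 otherwise. With A = λ₁ + 1 = M t + r,
-- B = λ₂ = L t + s and U_n = (z^n − z^{-n}) / (z − z^{-1}) the left-hand side is therefore
--   Σ_{i ≤ M, j ≤ L} F(i t + r, j t + s),   F(p,q) = U_p U_{q+1} − U_{p+1} U_q = U_{p−q},
-- while the right-hand side is its term F(A,B). Multiplying the equality of both by
-- (z − z^{-1}) (1 − z^t)² and a monomial, the geometric sums telescope to
--   (z^r − z^{t+A}) (z^s − z^{t+B}) (z^{A+r} − z^{B+s}) = (1 − z^t)² z^{r+s} (z^{2A} − z^{2B}).
-- The monomial z^{r+s+2B} can only be balanced if B = s, and then z^{2r+A+B} only if
-- A = r or A + r = t + 2B, which leaves the cores and the exceptional family.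
module Submission where

open import Algebra.Apartness.Bundles using (HeytingField; HeytingCommutativeRing)
open import Algebra.Bundles using (CommutativeRing; RawSemiring; Semiring)
import Algebra.Solver.Ring
open import Algebra.Solver.Ring.AlmostCommutativeRing using (fromCommutativeRing; _-Raw-AlmostCommutative⟶_)
open import Algebra.Structures using (IsCommutativeRing)
open import Data.Bool using (Bool; true; false; _∧_; if_then_else_)
open import Data.Bool.Properties using (∧-identityʳ)
open import Data.Fin as Fin using (Fin; zero; suc; toℕ)
import Data.Fin.Properties as Fin
open import Data.Integer as ℤ using (ℤ; _⊖_; 0ℤ; 1ℤ; -1ℤ)
import Data.Integer.Properties as ℤ
open import Data.List using (List; []; _∷_; _++_; map; filter; foldr; concat; drop; length; cartesianProductWith; allFin; tabulate; downFrom)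
import Data.List.Properties as List
open import Data.List.Membership.Propositional using (_∈_)
open import Data.List.Membership.Propositional.Properties using (∈-filter⁺; ∈-filter⁻; ∈-length; ∈-downFrom⁺; ∈-downFrom⁻)
open import Data.List.Relation.Binary.Permutation.Propositional using (_↭_; ↭-reflexive)
open import Data.List.Relation.Binary.Prefix.Heterogeneous.Properties using (prefix?)
open import Data.List.Relation.Unary.All as All using (All; []; _∷_)
import Data.List.Relation.Unary.All.Properties as All
open import Data.List.Relation.Unary.AllPairs using (AllPairs; []; _∷_)
import Data.List.Relation.Unary.AllPairs.Properties as AllPairs
open import Data.List.Relation.Unary.Any using (here; there)
open import Data.List.Relation.Unary.Linked using (linked?)
open import Data.Maybe as Maybe using ()
open import Data.Nat as ℕ using (ℕ; zero; suc; z≤n; s≤s; z<s; s<s; NonZero)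
open import Data.Nat.Divisibility using (divides; n∣m*n)
open import Data.Nat.DivMod using (_/_; _%_; m≡m%n+[m/n]*n; m%n<n; m*n/n≡m; m/n≡0⇒m<n; m<n⇒m/n≡0; m<n⇒m%n≡m; [m+n]%n≡m%n; [m+kn]%n≡m%n; +-distrib-/-∣ˡ)
import Data.Nat.Properties as ℕ
open import Data.List.Membership.DecPropositional ℕ._≟_ using (_∈?_)
open import Data.Nat.Tactic.RingSolver using (solve-∀)
open import Data.Product using (Σ-syntax; _×_; _,_; proj₁; proj₂)
open import Data.Sum as Sum using (_⊎_; inj₁; inj₂)
open import Data.Vec as Vec using (Vec; []; _∷_; lookup)
import Data.Vec.Properties as Vec
open import Defs
open import Function using (_∘_; id)
open import Function.Bundles using (_⇔_; mk⇔; Equivalence)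
open import Level using (Level)
open import Relation.Binary.Definitions using (tri<; tri≈; tri>)
open import Relation.Binary.PropositionalEquality as ≡ using (_≡_; _≢_)
open import Relation.Nullary using (Dec; does; yes; no; ¬_; ¬?; contradiction; dec⇒maybe)
open import Relation.Nullary.Decidable using (_×-dec_; dec-true; dec-false)
open import Relation.Unary using (Pred; Decidable)

-- Solving ring equations with integer coefficients

module RingSolver {c ℓ} (R : CommutativeRing c ℓ) where
  open CommutativeRing R hiding (zero)
  open import Data.Integer using (+_; -[1+_])
  open import Algebra.Properties.Ring ring using (-‿distribˡ-*; -‿distribʳ-*; -0#≈0#)
  open import Algebra.Properties.AbelianGroup +-abelianGroup using (⁻¹-∙-comm; ⁻¹-involutive)
  open import Algebra.Properties.CommutativeSemigroup +-commutativeSemigroup using (interchange)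
  open import Algebra.Properties.Semiring.Mult.TCOptimised semiring using (1+×; ×-homo-+; ×1-homo-*) renaming (_×_ to _·_)
  open import Relation.Binary.Reasoning.Setoid setoid

  -- Equality in `R` need not be decidable, so normal forms have coefficients in ℤ. With the
  -- optimised multiple, `1 · 1#` reduces to `1#`, which makes `:0` and `:1` denote `0#` and `1#` on
  -- the nose.
  ⟦_⟧ : ℤ → Carrier
  ⟦ + n ⟧      = n · 1#
  ⟦ -[1+ n ] ⟧ = - (suc n · 1#)

  ⊖-homo : ∀ m n → ⟦ m ⊖ n ⟧ ≈ m · 1# - n · 1#
  ⊖-homo zero    zero    = sym (-‿inverseʳ 0#)
  ⊖-homo zero    (suc n) = sym (+-identityˡ _)
  ⊖-homo (suc m) zero    = sym (trans (+-congˡ -0#≈0#) (+-identityʳ _))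
  ⊖-homo (suc m) (suc n) = begin
    ⟦ suc m ⊖ suc n ⟧              ≡⟨ ≡.cong ⟦_⟧ (ℤ.[1+m]⊖[1+n]≡m⊖n m n) ⟩
    ⟦ m ⊖ n ⟧                      ≈⟨ ⊖-homo m n ⟩
    m · 1# - n · 1#                ≈⟨ +-identityˡ _ ⟨
    0# + (m · 1# - n · 1#)         ≈⟨ +-congʳ (-‿inverseʳ 1#) ⟨
    1# - 1# + (m · 1# - n · 1#)    ≈⟨ interchange _ _ _ _ ⟩
    1# + m · 1# + (- 1# - n · 1#)   ≈⟨ +-congˡ (⁻¹-∙-comm _ _) ⟩
    1# + m · 1# - (1# + n · 1#)   ≈⟨ +-cong (1+× m 1#) (-‿cong (1+× n 1#)) ⟨
    suc m · 1# - suc n · 1#        ∎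

  +-homo : ∀ i j → ⟦ i ℤ.+ j ⟧ ≈ ⟦ i ⟧ + ⟦ j ⟧
  +-homo (+ m)      (+ n)      = ×-homo-+ 1# m n
  +-homo (+ m)      -[1+ n ]   = ⊖-homo m (suc n)
  +-homo -[1+ m ]   (+ n)      = trans (⊖-homo n (suc m)) (+-comm _ _)
  +-homo -[1+ m ]   -[1+ n ]   = begin
    - (suc (suc (m ℕ.+ n)) · 1#)      ≡⟨ ≡.cong (λ k → - (suc k · 1#)) (ℕ.+-suc m n) ⟨
    - ((suc m ℕ.+ suc n) · 1#)        ≈⟨ -‿cong (×-homo-+ 1# (suc m) (suc n)) ⟩
    - (suc m · 1# + suc n · 1#)       ≈⟨ ⁻¹-∙-comm _ _ ⟨
    - (suc m · 1#) - suc n · 1#       ∎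

  -‿homo : ∀ i → ⟦ ℤ.- i ⟧ ≈ - ⟦ i ⟧
  -‿homo (+ zero)  = sym -0#≈0#
  -‿homo (+ suc n) = refl
  -‿homo -[1+ n ]  = sym (⁻¹-involutive _)

  +*-homo : ∀ m j → ⟦ + m ℤ.* j ⟧ ≈ m · 1# * ⟦ j ⟧
  +*-homo m (+ n) = begin
    ⟦ + m ℤ.* + n ⟧   ≡⟨ ≡.cong ⟦_⟧ (ℤ.pos-* m n) ⟨
    (m ℕ.* n) · 1#    ≈⟨ ×1-homo-* m n ⟩
    m · 1# * n · 1#   ∎
  +*-homo m -[1+ n ] = begin
    ⟦ + m ℤ.* -[1+ n ] ⟧        ≡⟨ ≡.cong ⟦_⟧ (ℤ.neg-distribʳ-* (+ m) (+ suc n)) ⟨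
    ⟦ ℤ.- (+ m ℤ.* + suc n) ⟧   ≈⟨ -‿homo (+ m ℤ.* + suc n) ⟩
    - ⟦ + m ℤ.* + suc n ⟧       ≈⟨ -‿cong (+*-homo m (+ suc n)) ⟩
    - (m · 1# * suc n · 1#)     ≈⟨ -‿distribʳ-* _ _ ⟩
    m · 1# * - (suc n · 1#)     ∎

  *-homo : ∀ i j → ⟦ i ℤ.* j ⟧ ≈ ⟦ i ⟧ * ⟦ j ⟧
  *-homo (+ m) j = +*-homo m j
  *-homo -[1+ m ] j = begin
    ⟦ -[1+ m ] ℤ.* j ⟧        ≡⟨ ≡.cong ⟦_⟧ (ℤ.neg-distribˡ-* (+ suc m) j) ⟨
    ⟦ ℤ.- (+ suc m ℤ.* j) ⟧   ≈⟨ -‿homo (+ suc m ℤ.* j) ⟩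
    - ⟦ + suc m ℤ.* j ⟧       ≈⟨ -‿cong (+*-homo (suc m) j) ⟩
    - (suc m · 1# * ⟦ j ⟧)    ≈⟨ -‿distribˡ-* _ _ ⟩
    - (suc m · 1#) * ⟦ j ⟧    ∎

  morphism : ℤ.+-*-rawRing -Raw-AlmostCommutative⟶ fromCommutativeRing R
  morphism = record
    { ⟦_⟧ = ⟦_⟧ ; +-homo = +-homo ; *-homo = *-homo ; -‿homo = -‿homo
    ; 0-homo = refl ; 1-homo = refl }

  open Algebra.Solver.Ring ℤ.+-*-rawRing (fromCommutativeRing R) morphism
    (λ i j → Maybe.map (λ p → reflexive (≡.cong ⟦_⟧ p)) (dec⇒maybe (i ℤ.≟ j)))
    public using (Polynomial; con; solve; _:=_; _:+_; _:*_; _:-_; :-_)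

  :0 :1 : ∀ {n} → Polynomial n
  :0 = con (+ 0)
  :1 = con (+ 1)

-- Schur polynomials of two-rowed shapes

module JacobiTrudi {c ℓ} (R : CommutativeRing c ℓ) where
  open CommutativeRing R hiding (zero)
  open RingSolver R
  open import Algebra.Properties.Semiring.Sum semiring
  open import Relation.Binary.Reasoning.Setoid setoid

  private variable
    a b p : Level
    A : Set a
    B : Set b

  -- Conditions become weights 0 and 1, so that a sum over a filtered list is a sum over all words,
  -- in which summations can be exchanged and conjunctions become products.
  ⟪_⟫ : Bool → Carrier
  ⟪ t ⟫ = if t then 1# else 0#

  ⟪⟫-∧ : ∀ s t → ⟪ s ∧ t ⟫ ≈ ⟪ s ⟫ * ⟪ t ⟫
  ⟪⟫-∧ true  t = sym (*-identityˡ _)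
  ⟪⟫-∧ false t = sym (zeroˡ _)

  lsum : (A → Carrier) → List A → Carrier
  lsum f xs = foldr _+_ 0# (map f xs)

  lsum-cong : ∀ {f g : A → Carrier} → (∀ x → f x ≈ g x) → ∀ xs → lsum f xs ≈ lsum g xs
  lsum-cong f≈g []       = refl
  lsum-cong f≈g (x ∷ xs) = +-cong (f≈g x) (lsum-cong f≈g xs)

  lsum-++ : ∀ (f : A → Carrier) xs ys → lsum f (xs ++ ys) ≈ lsum f xs + lsum f ys
  lsum-++ f []       ys = sym (+-identityˡ _)
  lsum-++ f (x ∷ xs) ys = trans (+-congˡ (lsum-++ f xs ys)) (sym (+-assoc _ _ _))

  lsum-map : ∀ (f : B → Carrier) (g : A → B) xs → lsum f (map g xs) ≡ lsum (f ∘ g) xs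
  lsum-map f g xs = ≡.cong (foldr _+_ 0#) (≡.sym (List.map-∘ xs))

  lsum-product : ∀ {d} {C : Set d} (f : C → Carrier) (g : A → B → C) xs ys →
    lsum f (cartesianProductWith g xs ys) ≈ lsum (λ x → lsum (f ∘ g x) ys) xs
  lsum-product f g []       ys = refl
  lsum-product f g (x ∷ xs) ys = trans (lsum-++ f (map (g x) ys) _)
    (+-cong (reflexive (lsum-map f (g x) ys)) (lsum-product f g xs ys))

  lsum-filter : ∀ {P : Pred A p} (P? : Decidable P) (f : A → Carrier) xs →
    lsum f (filter P? xs) ≈ lsum (λ x → ⟪ does (P? x) ⟫ * f x) xs
  lsum-filter P? f []       = refl
  lsum-filter P? f (x ∷ xs) with does (P? x)
  ... | true  = +-cong (sym (*-identityˡ _)) (lsum-filter P? f xs)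
  ... | false = trans (lsum-filter P? f xs) (sym (trans (+-congʳ (zeroˡ _)) (+-identityˡ _)))

  lsum-distribˡ : ∀ c (f : A → Carrier) xs → c * lsum f xs ≈ lsum (λ x → c * f x) xs
  lsum-distribˡ c f []       = zeroʳ c
  lsum-distribˡ c f (x ∷ xs) = trans (distribˡ c _ _) (+-congˡ (lsum-distribˡ c f xs))

  lsum-tabulate : ∀ {n} (f : A → Carrier) (g : Fin n → A) → lsum f (tabulate g) ≡ sum (f ∘ g)
  lsum-tabulate {n = zero}  f g = ≡.refl
  lsum-tabulate {n = suc n} f g = ≡.cong₂ _+_ ≡.refl (lsum-tabulate f (g ∘ suc))

  lsum-∑ : ∀ {n} (f : A → Fin n → Carrier) xs →
    lsum (λ x → sum (f x)) xs ≈ ∑[ i < n ] lsum (λ x → f x i) xs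
  lsum-∑ {n = n} f []       = sym (sum-replicate-zero n)
  lsum-∑ {n = n} f (x ∷ xs) = trans (+-congˡ (lsum-∑ f xs)) (sym (∑-distrib-+ (f x) _))

  lsum-words-zero : ∀ {n} (f : List (Fin n) → Carrier) → lsum f (words n 0) ≈ f []
  lsum-words-zero f = +-identityʳ _

  lsum-words-suc : ∀ {n} k (f : List (Fin n) → Carrier) →
    lsum f (words n (suc k)) ≈ ∑[ p < n ] lsum (λ w → f (p ∷ w)) (words n k)
  lsum-words-suc {n} k f = trans (lsum-product f _∷_ (allFin n) (words n k))
    (reflexive (lsum-tabulate (λ p → lsum (λ w → f (p ∷ w)) (words n k)) id))

  ∑-cong : ∀ {n} {f g : Fin n → Carrier} → (∀ i → f i ≈ g i) → sum f ≈ sum g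
  ∑-cong f≈g = sum-cong-≋ f≈g

  module _ {n} (x : Fin n → Carrier) where

    monomial : List (Fin n) → Carrier
    monomial w = foldr _*_ 1# (map x w)

    [_≤_] [_<_] : Fin n → Fin n → Carrier
    [ i ≤ j ] = ⟪ does (i Fin.≤? j) ⟫
    [ i < j ] = ⟪ does (i Fin.<? j) ⟫

    increasing : Fin n → List (Fin n) → Carrier
    increasing i w = ⟪ does (linked? Fin._≤?_ (i ∷ w)) ⟫

    above : List (Fin n) → List (Fin n) → Carrier
    above v w = ⟪ does (prefix? (λ i j → j Fin.<? i) w v) ⟫

    -- h k i is the complete homogeneous polynomial of degree k in the variables
    -- of index at least i, and h⁻ k i the one of degree k - 1.
    h-term : Fin n → List (Fin n) → Carrier
    h-term i w = increasing i w * monomial w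

    h h⁻ : ℕ → Fin n → Carrier
    h k i = lsum (h-term i) (words n k)
    h⁻ zero    i = 0#
    h⁻ (suc k) i = h k i

    h-zero : ∀ i → h 0 i ≈ 1#
    h-zero i = trans (lsum-words-zero (h-term i)) (*-identityˡ 1#)

    h-suc : ∀ k i → h (suc k) i ≈ ∑[ p < n ] ([ i ≤ p ] * x p * h k p)
    h-suc k i = trans (lsum-words-suc k (h-term i)) (∑-cong λ p → begin
      lsum (λ w → increasing i (p ∷ w) * (x p * monomial w)) (words n k)
        ≈⟨ lsum-cong (λ w → trans (*-congʳ (⟪⟫-∧ (does (i Fin.≤? p)) _))
             (solve 4 (λ a b c d → a :* b :* (c :* d) := a :* c :* (b :* d)) refl _ _ _ _)) (words n k) ⟩
      lsum (λ w → [ i ≤ p ] * x p * (increasing p w * monomial w)) (words n k)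
        ≈⟨ lsum-distribˡ _ _ (words n k) ⟨
      [ i ≤ p ] * x p * h k p ∎)

    tableau-term : Fin n → Fin n → List (Fin n) → List (Fin n) → Carrier
    tableau-term i j v w = increasing i v * increasing j w * above v w * (monomial v * monomial w)

    -- The generating function of the two-rowed tableaux with first row bounded
    -- below by i and second row bounded below by j.
    tableauSum : ℕ → ℕ → Fin n → Fin n → Carrier
    tableauSum a b i j = lsum (λ v → lsum (tableau-term i j v) (words n b)) (words n a)

    tableauSum-zero : ∀ a i j → tableauSum a 0 i j ≈ h a i
    tableauSum-zero a i j = lsum-cong (λ v → trans (lsum-words-zero (tableau-term i j v))
      (solve 2 (λ y z → y :* :1 :* :1 :* (z :* :1) := y :* z) refl _ _)) (words n a)

    tableauSum-suc : ∀ a b i j → tableauSum (suc a) (suc b) i j ≈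
      ∑[ p < n ] ∑[ q < n ] ([ i ≤ p ] * [ j ≤ q ] * [ p < q ] * (x p * x q) * tableauSum a b p q)
    tableauSum-suc a b i j = trans (lsum-words-suc a (λ v → lsum (tableau-term i j v) (words n (suc b)))) (∑-cong λ p →
      trans (lsum-cong (λ v → lsum-words-suc b (tableau-term i j (p ∷ v))) (words n a))
      (trans (lsum-∑ {n = n} _ (words n a)) (∑-cong λ q → begin
        lsum (λ v → lsum (λ w → increasing i (p ∷ v) * increasing j (q ∷ w) * above (p ∷ v) (q ∷ w)
                * (x p * monomial v * (x q * monomial w))) (words n b)) (words n a)
          ≈⟨ lsum-cong (λ v → lsum-cong (λ w → trans
               (*-congʳ (*-cong (*-cong (⟪⟫-∧ (does (i Fin.≤? p)) _) (⟪⟫-∧ (does (j Fin.≤? q)) _))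
                                (⟪⟫-∧ (does (p Fin.<? q)) _)))
               (regroup _ _ _ _ _ _ _ _ _ _))
               (words n b)) (words n a) ⟩
        lsum (λ v → lsum (λ w → w₀ p q * tableau-term p q v w) (words n b)) (words n a)
          ≈⟨ lsum-cong (λ v → lsum-distribˡ (w₀ p q) (tableau-term p q v) (words n b)) (words n a) ⟨
        lsum (λ v → w₀ p q * lsum (tableau-term p q v) (words n b)) (words n a)
          ≈⟨ lsum-distribˡ (w₀ p q) _ (words n a) ⟨
        w₀ p q * tableauSum a b p q ∎)))
      where
      w₀ : Fin n → Fin n → Carrier
      w₀ p q = [ i ≤ p ] * [ j ≤ q ] * [ p < q ] * (x p * x q)
      regroup : ∀ a b c d e f g h k l →
        a * b * (c * d) * (e * f) * (g * h * (k * l)) ≈ a * c * e * (g * k) * (b * d * f * (h * l))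
      regroup = solve 10 (λ a b c d e f g h k l →
        a :* b :* (c :* d) :* (e :* f) :* (g :* h :* (k :* l)) := a :* c :* e :* (g :* k) :* (b :* d :* f :* (h :* l))) refl

    -- A weakly increasing word bounded below by `i` either begins with a letter `p < q`, or is
    -- bounded below by `q`. The empty word is of the second kind only, in accordance with
    -- `h⁻ 0 p = 0`.
    h-split : ∀ b {i q} → i Fin.≤ q →
      ∑[ p < n ] ([ i ≤ p ] * [ p < q ] * x p * h⁻ b p) + h b q ≈ h b i
    h-split zero {i} {q} i≤q = begin
      ∑[ p < n ] ([ i ≤ p ] * [ p < q ] * x p * 0#) + h 0 q  ≈⟨ +-cong (∑-cong {n} λ p → zeroʳ _) (h-zero q) ⟩
      ∑[ p < n ] 0# + 1#                                     ≈⟨ +-congʳ (sum-replicate-zero n) ⟩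
      0# + 1#                                                ≈⟨ +-identityˡ 1# ⟩
      1#                                                     ≈⟨ h-zero i ⟨
      h 0 i                                                  ∎
    h-split (suc b) {i} {q} i≤q = begin
      ∑[ p < n ] ([ i ≤ p ] * [ p < q ] * x p * h b p) + h (suc b) q
        ≈⟨ +-congˡ (h-suc b q) ⟩
      ∑[ p < n ] ([ i ≤ p ] * [ p < q ] * x p * h b p) + ∑[ p < n ] ([ q ≤ p ] * x p * h b p)
        ≈⟨ ∑-distrib-+ {n} _ _ ⟨
      ∑[ p < n ] ([ i ≤ p ] * [ p < q ] * x p * h b p + [ q ≤ p ] * x p * h b p)
        ≈⟨ ∑-cong (λ p → trans (solve 5 (λ a b c d e → a :* b :* d :* e :+ c :* d :* e := (a :* b :+ c) :* (d :* e)) refl _ _ _ _ _)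
             (trans (*-congʳ (step p)) (sym (*-assoc _ _ _)))) ⟩
      ∑[ p < n ] ([ i ≤ p ] * x p * h b p)
        ≈⟨ h-suc b i ⟨
      h (suc b) i ∎
      where
      step : ∀ p → [ i ≤ p ] * [ p < q ] + [ q ≤ p ] ≈ [ i ≤ p ]
      step p with p Fin.<? q
      ... | yes p<q rewrite dec-true (p Fin.<? q) p<q | dec-false (q Fin.≤? p) (ℕ.<⇒≱ p<q) =
        trans (+-identityʳ _) (*-identityʳ _)
      ... | no p≮q rewrite dec-false (p Fin.<? q) p≮q | dec-true (q Fin.≤? p) (ℕ.≮⇒≥ p≮q)
                         | dec-true (i Fin.≤? p) (ℕ.≤-trans i≤q (ℕ.≮⇒≥ p≮q)) =
        trans (+-congʳ (zeroʳ _)) (+-identityˡ _)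

    -- Expand along the first column, p above q: the pairs with q ≤ p, which no tableau has,
    -- make up h (suc a) q * h b q, and by h-split the rest of the subtracted term is
    -- covered by the induction hypothesis.
    jacobiTrudi : ∀ a b {i j} → b ℕ.≤ a → i Fin.≤ j →
      tableauSum a b i j + h (suc a) j * h⁻ b i ≈ h a i * h b j
    jacobiTrudi a zero {i} {j} _ _ = begin
      tableauSum a 0 i j + h (suc a) j * 0#  ≈⟨ +-cong (tableauSum-zero a i j) (zeroʳ _) ⟩
      h a i + 0#                             ≈⟨ +-identityʳ _ ⟩
      h a i                                  ≈⟨ *-identityʳ _ ⟨
      h a i * 1#                             ≈⟨ *-congˡ (h-zero j) ⟨
      h a i * h 0 j                          ∎
    jacobiTrudi (suc a) (suc b) {i} {j} (s≤s b≤a) i≤j = begin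
      tableauSum (suc a) (suc b) i j + h (suc (suc a)) j * h b i
        ≈⟨ +-cong (trans (tableauSum-suc a b i j) (∑-comm {n} {n} _)) second ⟩
      ∑[ q < n ] ∑[ p < n ] T p q + ∑[ q < n ] ∑[ p < n ] U p q
        ≈⟨ ∑-distrib-+ {n} _ _ ⟨
      ∑[ q < n ] (∑[ p < n ] T p q + ∑[ p < n ] U p q)
        ≈⟨ ∑-cong {n} (λ q → trans (sym (∑-distrib-+ {n} _ _)) (∑-cong (λ p → pointwise p q))) ⟩
      ∑[ q < n ] ∑[ p < n ] V p q
        ≈⟨ ∑-comm {n} {n} _ ⟩
      ∑[ p < n ] ∑[ q < n ] V p q
        ≈⟨ first ⟨
      h (suc a) i * h (suc b) j ∎
      where
      T U V : Fin n → Fin n → Carrier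
      T p q = [ i ≤ p ] * [ j ≤ q ] * [ p < q ] * (x p * x q) * tableauSum a b p q
      U p q = [ j ≤ q ] * x q * (h (suc a) q * ([ i ≤ p ] * [ p < q ] * x p * h⁻ b p) + [ q ≤ p ] * x p * h a p * h b q)
      V p q = [ i ≤ p ] * x p * h a p * ([ j ≤ q ] * x q * h b q)

      first : h (suc a) i * h (suc b) j ≈ ∑[ p < n ] ∑[ q < n ] V p q
      first = trans (*-cong (h-suc a i) (h-suc b j)) (trans (*-distribʳ-sum {n} _ (λ p → [ i ≤ p ] * x p * h a p))
        (∑-cong (λ p → *-distribˡ-sum {n} ([ i ≤ p ] * x p * h a p) (λ q → [ j ≤ q ] * x q * h b q))))

      second : h (suc (suc a)) j * h b i ≈ ∑[ q < n ] ∑[ p < n ] U p q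
      second = trans (*-congʳ (h-suc (suc a) j)) (trans (*-distribʳ-sum {n} _ _) (∑-cong inner))
        where
        inner : ∀ q → [ j ≤ q ] * x q * h (suc a) q * h b i ≈ ∑[ p < n ] U p q
        inner q with j Fin.≤? q
        ... | no j≰q rewrite dec-false (j Fin.≤? q) j≰q = trans (solve 3 (λ y u v → :0 :* y :* u :* v := :0) refl _ _ _)
                (trans (sym (sum-replicate-zero n)) (∑-cong {n} (λ p → solve 2 (λ y u → :0 := :0 :* y :* u) refl _ _)))
        ... | yes j≤q rewrite dec-true (j Fin.≤? q) j≤q = begin
          1# * x q * h (suc a) q * h b i
            ≈⟨ *-congˡ (h-split b (ℕ.≤-trans i≤j j≤q)) ⟨
          1# * x q * h (suc a) q * (∑[ p < n ] ([ i ≤ p ] * [ p < q ] * x p * h⁻ b p) + h b q)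
            ≈⟨ solve 4 (λ x h s k → x :* h :* (s :+ k) := x :* (h :* s :+ h :* k)) refl _ _ _ _ ⟩
          1# * x q * (h (suc a) q * ∑[ p < n ] ([ i ≤ p ] * [ p < q ] * x p * h⁻ b p) + h (suc a) q * h b q)
            ≈⟨ *-congˡ (+-cong (*-distribˡ-sum {n} _ _) (trans (*-congʳ (h-suc a q)) (*-distribʳ-sum {n} _ _))) ⟩
          1# * x q * (∑[ p < n ] (h (suc a) q * ([ i ≤ p ] * [ p < q ] * x p * h⁻ b p)) + ∑[ p < n ] ([ q ≤ p ] * x p * h a p * h b q))
            ≈⟨ *-congˡ (∑-distrib-+ {n} _ _) ⟨
          1# * x q * ∑[ p < n ] (h (suc a) q * ([ i ≤ p ] * [ p < q ] * x p * h⁻ b p) + [ q ≤ p ] * x p * h a p * h b q)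
            ≈⟨ *-distribˡ-sum {n} _ _ ⟩
          ∑[ p < n ] (1# * x q * (h (suc a) q * ([ i ≤ p ] * [ p < q ] * x p * h⁻ b p) + [ q ≤ p ] * x p * h a p * h b q)) ∎

      pointwise : ∀ p q → T p q + U p q ≈ V p q
      pointwise p q with j Fin.≤? q
      ... | no j≰q rewrite dec-false (j Fin.≤? q) j≰q = solve 8 (λ a c xp xq t u k m →
              a :* :0 :* c :* (xp :* xq) :* t :+ :0 :* xq :* u := k :* (:0 :* xq :* m))
              refl [ i ≤ p ] [ p < q ] (x p) (x q) _ _ _ _
      ... | yes j≤q rewrite dec-true (j Fin.≤? q) j≤q with p Fin.<? q
      ...   | yes p<q rewrite dec-true (p Fin.<? q) p<q | dec-false (q Fin.≤? p) (ℕ.<⇒≱ p<q) = begin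
        [ i ≤ p ] * 1# * 1# * (x p * x q) * tableauSum a b p q +
          1# * x q * (h (suc a) q * ([ i ≤ p ] * 1# * x p * h⁻ b p) + 0# * x p * h a p * h b q)
          ≈⟨ solve 8 (λ c xp xq t ha' h' ha hb →
              c :* :1 :* :1 :* (xp :* xq) :* t :+ :1 :* xq :* (ha' :* (c :* :1 :* xp :* h') :+ :0 :* xp :* ha :* hb)
              := c :* xp :* xq :* (t :+ ha' :* h')) refl _ _ _ _ _ _ _ _ ⟩
        [ i ≤ p ] * x p * x q * (tableauSum a b p q + h (suc a) q * h⁻ b p)
          ≈⟨ *-congˡ (jacobiTrudi a b b≤a (ℕ.<⇒≤ p<q)) ⟩
        [ i ≤ p ] * x p * x q * (h a p * h b q)
          ≈⟨ solve 5 (λ c xp xq ha hb → c :* xp :* xq :* (ha :* hb) := c :* xp :* ha :* (:1 :* xq :* hb)) refl _ _ _ _ _ ⟩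
        [ i ≤ p ] * x p * h a p * (1# * x q * h b q) ∎
      -- The second summand of `U` has no factor `[ i ≤ p ]`, whereas `V` has one; it equals 1 here
      -- because `i ≤ j ≤ q ≤ p`.
      ...   | no p≮q rewrite dec-false (p Fin.<? q) p≮q | dec-true (q Fin.≤? p) (ℕ.≮⇒≥ p≮q)
                | dec-true (i Fin.≤? p) (ℕ.≤-trans i≤j (ℕ.≤-trans j≤q (ℕ.≮⇒≥ p≮q))) =
        solve 7 (λ xp xq t ha' h' ha hb →
              :1 :* :1 :* :0 :* (xp :* xq) :* t :+ :1 :* xq :* (ha' :* (:1 :* :0 :* xp :* h') :+ :1 :* xp :* ha :* hb)
              := :1 :* xp :* ha :* (:1 :* xq :* hb)) refl _ _ _ _ _ _ _

-- Complete homogeneous polynomials and the effect of adjoining the roots of unity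

module CompleteHomogeneous {c ℓ} (R : CommutativeRing c ℓ) where
  open CommutativeRing R hiding (zero)
  open RingSolver R
  open JacobiTrudi R
  open import Algebra.Properties.Semiring.Sum semiring
  open import Algebra.Properties.AbelianGroup +-abelianGroup using (∙-cancelˡ)
  open import Relation.Binary.Reasoning.Setoid setoid

  hₖ : ∀ {n} → Vec Carrier n → ℕ → Carrier
  hₖ []       zero    = 1#
  hₖ []       (suc k) = 0#
  hₖ (x ∷ xs) zero    = 1#
  hₖ (x ∷ xs) (suc k) = hₖ xs (suc k) + x * hₖ (x ∷ xs) k

  hₖ-zero : ∀ {n} (xs : Vec Carrier n) → hₖ xs 0 ≈ 1#
  hₖ-zero []       = refl
  hₖ-zero (x ∷ xs) = refl

  -- A word bounded below by `suc i` never contains the letter `zero`, so the variable `y` does not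
  -- occur.
  h-tail : ∀ {n} y (xs : Vec Carrier n) k i → h (lookup (y ∷ xs)) k (suc i) ≈ h (lookup xs) k i
  h-tail y xs zero    i = trans (h-zero (lookup (y ∷ xs)) (suc i)) (sym (h-zero (lookup xs) i))
  h-tail {n} y xs (suc k) i = begin
    h (lookup (y ∷ xs)) (suc k) (suc i)
      ≈⟨ h-suc (lookup (y ∷ xs)) k (suc i) ⟩
    0# * y * h (lookup (y ∷ xs)) k zero + ∑[ p < n ] ([_≤_] (lookup (y ∷ xs)) (suc i) (suc p) * lookup xs p * h (lookup (y ∷ xs)) k (suc p))
      ≈⟨ +-cong (solve 2 (λ y z → :0 :* y :* z := :0) refl _ _)
           (∑-cong {n} λ p → *-cong (*-congʳ (reflexive (shift i p))) (h-tail y xs k p)) ⟩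
    0# + ∑[ p < n ] ([_≤_] (lookup xs) i p * lookup xs p * h (lookup xs) k p)
      ≈⟨ +-identityˡ _ ⟩
    ∑[ p < n ] ([_≤_] (lookup xs) i p * lookup xs p * h (lookup xs) k p)
      ≈⟨ h-suc (lookup xs) k i ⟨
    h (lookup xs) (suc k) i ∎
    where
    shift : ∀ {n} (i p : Fin n) → ⟪ does (suc i Fin.≤? suc p) ⟫ ≡ ⟪ does (i Fin.≤? p) ⟫
    shift zero    p = ≡.refl
    shift (suc i) p = ≡.refl

  h-lookup : ∀ {n} y (xs : Vec Carrier n) k → h (lookup (y ∷ xs)) k zero ≈ hₖ (y ∷ xs) k
  ∑-h : ∀ {n} (xs : Vec Carrier n) k → ∑[ p < n ] (lookup xs p * h (lookup xs) k p) ≈ hₖ xs (suc k)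

  h-lookup y xs zero = h-zero (lookup (y ∷ xs)) zero
  h-lookup {n} y xs (suc k) = begin
    h (lookup (y ∷ xs)) (suc k) zero
      ≈⟨ h-suc (lookup (y ∷ xs)) k zero ⟩
    1# * y * h (lookup (y ∷ xs)) k zero + ∑[ p < n ] (1# * lookup xs p * h (lookup (y ∷ xs)) k (suc p))
      ≈⟨ +-cong (*-cong (*-identityˡ y) (h-lookup y xs k))
           (∑-cong {n} λ p → *-cong (*-identityˡ _) (h-tail y xs k p)) ⟩
    y * hₖ (y ∷ xs) k + ∑[ p < n ] (lookup xs p * h (lookup xs) k p)
      ≈⟨ +-congˡ (∑-h xs k) ⟩
    y * hₖ (y ∷ xs) k + hₖ xs (suc k)
      ≈⟨ +-comm _ _ ⟩
    hₖ (y ∷ xs) (suc k) ∎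

  ∑-h []       k = refl
  ∑-h {suc n} (y ∷ xs) k = begin
    ∑[ p < suc n ] (lookup (y ∷ xs) p * h (lookup (y ∷ xs)) k p)
      ≈⟨ ∑-cong {suc n} (λ p → *-congʳ {h (lookup (y ∷ xs)) k p} (*-identityˡ (lookup (y ∷ xs) p))) ⟨
    ∑[ p < suc n ] (1# * lookup (y ∷ xs) p * h (lookup (y ∷ xs)) k p)
      ≈⟨ h-suc (lookup (y ∷ xs)) k zero ⟨
    h (lookup (y ∷ xs)) (suc k) zero
      ≈⟨ h-lookup y xs (suc k) ⟩
    hₖ (y ∷ xs) (suc k) ∎

  -- Shifting the index by one makes sense of h₋₁ = 0.
  h₋₁ : ∀ {n} → Vec Carrier n → ℕ → Carrier
  h₋₁ xs zero    = 0#
  h₋₁ xs (suc k) = hₖ xs k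

  monomial-++ : ∀ {n} (x : Fin n → Carrier) v w → monomial x (v ++ w) ≈ monomial x v * monomial x w
  monomial-++ x []      w = sym (*-identityˡ _)
  monomial-++ x (p ∷ v) w = trans (*-congˡ (monomial-++ x v w)) (sym (*-assoc _ _ _))

  -- The lower bound `zero` excludes no letter, and for two rows `semistandard?` is a conjunction of
  -- three tests: one for each row and one for the columns.
  schur-tableauSum : ∀ {n} (xs : Vec Carrier (suc n)) a b →
    schur (Semiring.rawSemiring semiring) xs (a ∷ b ∷ []) ≈ tableauSum (lookup xs) a b zero zero
  schur-tableauSum {n} xs a b = begin
    lsum weight (tableaux (suc n) (a ∷ b ∷ []))
      ≈⟨ lsum-filter semistandard? weight (fillings (suc n) (a ∷ b ∷ [])) ⟩
    lsum weight′ (fillings (suc n) (a ∷ b ∷ []))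
      ≈⟨ lsum-product weight′ _∷_ (words (suc n) a) _ ⟩
    lsum (λ v → lsum (λ r → weight′ (v ∷ r)) (cartesianProductWith _∷_ (words (suc n) b) ([] ∷ []))) (words (suc n) a)
      ≈⟨ lsum-cong (λ v → trans (lsum-product (λ r → weight′ (v ∷ r)) _∷_ (words (suc n) b) ([] ∷ []))
           (lsum-cong (λ w → trans (+-identityʳ _) (weight-term v w)) (words (suc n) b))) (words (suc n) a) ⟩
    tableauSum (lookup xs) a b zero zero ∎
    where
    weight weight′ : Filling (suc n) → Carrier
    weight T = monomial (lookup xs) (concat T)
    weight′ T = ⟪ does (semistandard? T) ⟫ * weight T

    linked-zero : ∀ (w : List (Fin (suc n))) →
      does (linked? Fin._≤?_ (zero ∷ w)) ≡ does (linked? Fin._≤?_ w)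
    linked-zero []      = ≡.refl
    linked-zero (p ∷ w) = ≡.refl

    weight-term : ∀ v w → weight′ (v ∷ w ∷ []) ≈ tableau-term (lookup xs) zero zero v w
    weight-term v w
      rewrite linked-zero v | linked-zero w | List.++-identityʳ w
            | ∧-identityʳ (does (linked? Fin._≤?_ w))
            | ∧-identityʳ (does (prefix? (λ (i j : Fin (suc n)) → j Fin.<? i) w v)) =
      *-cong (trans (⟪⟫-∧ (does (linked? Fin._≤?_ v) ∧ does (linked? Fin._≤?_ w)) _) (*-congʳ (⟪⟫-∧ (does (linked? Fin._≤?_ v)) _)))
             (monomial-++ (lookup xs) v w)

  schur-twoRows : ∀ {n} .{{_ : NonZero n}} (xs : Vec Carrier n) {a b} → b ℕ.≤ a →
    schur (Semiring.rawSemiring semiring) xs (a ∷ b ∷ [])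
      ≈ h₋₁ xs (suc a) * h₋₁ xs (suc b) - h₋₁ xs (2 ℕ.+ a) * h₋₁ xs b
  schur-twoRows {zero} {{()}} []
  schur-twoRows xs@(y ∷ ys) {a} {b} b≤a = begin
    schur (Semiring.rawSemiring semiring) xs (a ∷ b ∷ [])
      ≈⟨ schur-tableauSum xs a b ⟩
    T
      ≈⟨ solve 2 (λ p q → p := p :+ q :- q) refl T (h (lookup xs) (suc a) zero * h⁻ (lookup xs) b zero) ⟩
    T + h (lookup xs) (suc a) zero * h⁻ (lookup xs) b zero - h (lookup xs) (suc a) zero * h⁻ (lookup xs) b zero
      ≈⟨ +-cong (jacobiTrudi (lookup xs) a b b≤a z≤n) (-‿cong (*-cong (h-lookup y ys (suc a)) (h⁻-lookup b))) ⟩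
    h (lookup xs) a zero * h (lookup xs) b zero - hₖ xs (suc a) * h₋₁ xs b
      ≈⟨ +-congʳ (*-cong (h-lookup y ys a) (h-lookup y ys b)) ⟩
    hₖ xs a * hₖ xs b - hₖ xs (suc a) * h₋₁ xs b ∎
    where
    T = tableauSum (lookup xs) a b zero zero
    h⁻-lookup : ∀ b → h⁻ (lookup xs) b zero ≈ h₋₁ xs b
    h⁻-lookup zero    = refl
    h⁻-lookup (suc b) = h-lookup y ys b

  infixl 7 _⋆_
  -- The Cauchy product of two sequences. Shifting `f` instead of subtracting indices lets initial
  -- zeros of `f` be stripped one at a time.
  _⋆_ : (ℕ → Carrier) → (ℕ → Carrier) → ℕ → Carrier
  (f ⋆ g) zero    = f 0 * g 0
  (f ⋆ g) (suc n) = f 0 * g (suc n) + ((f ∘ suc) ⋆ g) n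

  ⋆-congʳ : ∀ {f f′} → (∀ k → f k ≈ f′ k) → ∀ g n → (f ⋆ g) n ≈ (f′ ⋆ g) n
  ⋆-congʳ f≈f′ g zero    = *-congʳ (f≈f′ 0)
  ⋆-congʳ f≈f′ g (suc n) = +-cong (*-congʳ (f≈f′ 0)) (⋆-congʳ (f≈f′ ∘ suc) g n)

  ⋆-linear : ∀ f x f′ g n → ((λ k → f k + x * f′ k) ⋆ g) n ≈ (f ⋆ g) n + x * (f′ ⋆ g) n
  ⋆-linear f x f′ g zero = solve 4 (λ f x f′ g → (f :+ x :* f′) :* g := f :* g :+ x :* (f′ :* g)) refl _ _ _ _
  ⋆-linear f x f′ g (suc n) = trans (+-congˡ (⋆-linear (f ∘ suc) x (f′ ∘ suc) g n))
    (solve 6 (λ f x f′ g s s′ → (f :+ x :* f′) :* g :+ (s :+ x :* s′) := f :* g :+ s :+ x :* (f′ :* g :+ s′)) refl _ _ _ _ _ _)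

  ⋆-zeroes : ∀ m {f} → (∀ k → k ℕ.< m → f k ≈ 0#) → ∀ g n → (f ⋆ g) (m ℕ.+ n) ≈ ((λ k → f (m ℕ.+ k)) ⋆ g) n
  ⋆-zeroes zero    f≈0 g n = refl
  ⋆-zeroes (suc m) f≈0 g n = trans (+-cong (trans (*-congʳ (f≈0 0 z<s)) (zeroˡ _))
    (⋆-zeroes m (λ k k<m → f≈0 (suc k) (s<s k<m)) g n)) (+-identityˡ _)

  ⋆-vanish : ∀ {f} g n → (∀ k → k ℕ.≤ n → f k ≈ 0#) → (f ⋆ g) n ≈ 0#
  ⋆-vanish g zero    f≈0 = trans (*-congʳ (f≈0 0 z≤n)) (zeroˡ _)
  ⋆-vanish g (suc n) f≈0 = trans (+-cong (trans (*-congʳ (f≈0 0 z≤n)) (zeroˡ _))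
    (⋆-vanish g n (λ k k≤n → f≈0 (suc k) (s≤s k≤n)))) (+-identityˡ _)

  ⋆-identity : ∀ {f} g n → f 0 ≈ 1# → (∀ k → k ℕ.< n → f (suc k) ≈ 0#) → (f ⋆ g) n ≈ g n
  ⋆-identity g zero    f₀≈1 f≈0 = trans (*-congʳ f₀≈1) (*-identityˡ _)
  ⋆-identity g (suc n) f₀≈1 f≈0 = trans (+-cong (trans (*-congʳ f₀≈1) (*-identityˡ _))
    (⋆-vanish g n (λ k k≤n → f≈0 k (s≤s k≤n)))) (+-identityʳ _)

  -- The generating series of `hₖ xs` is the product of the series 1/(1 - xT), so appending
  -- variables multiplies series. Linearity of `⋆` in its first argument matches the recursion of
  -- `hₖ` in its first variable.
  hₖ-++ : ∀ {m n} (xs : Vec Carrier m) (ys : Vec Carrier n) k → hₖ (xs Vec.++ ys) k ≈ (hₖ xs ⋆ hₖ ys) k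
  hₖ-++ []       ys k       = sym (⋆-identity (hₖ ys) k refl (λ _ _ → refl))
  hₖ-++ (x ∷ xs) ys zero    = sym (trans (*-congˡ (hₖ-zero ys)) (*-identityˡ 1#))
  hₖ-++ (x ∷ xs) ys (suc k) = begin
    hₖ (xs Vec.++ ys) (suc k) + x * hₖ (x ∷ xs Vec.++ ys) k
      ≈⟨ +-cong (hₖ-++ xs ys (suc k)) (*-congˡ (hₖ-++ (x ∷ xs) ys k)) ⟩
    hₖ xs 0 * hₖ ys (suc k) + ((hₖ xs ∘ suc) ⋆ hₖ ys) k + x * (hₖ (x ∷ xs) ⋆ hₖ ys) k
      ≈⟨ trans (+-congʳ (+-congʳ (*-congʳ (hₖ-zero xs)))) (+-assoc _ _ _) ⟩
    1# * hₖ ys (suc k) + (((hₖ xs ∘ suc) ⋆ hₖ ys) k + x * (hₖ (x ∷ xs) ⋆ hₖ ys) k)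
      ≈⟨ +-congˡ (⋆-linear (hₖ xs ∘ suc) x (hₖ (x ∷ xs)) (hₖ ys) k) ⟨
    (hₖ (x ∷ xs) ⋆ hₖ ys) (suc k) ∎

  progressionSum : ℕ → (ℕ → Carrier) → ℕ → ℕ → Carrier
  progressionSum t g zero    r = g r
  progressionSum t g (suc m) r = g (suc m ℕ.* t ℕ.+ r) + progressionSum t g m r

  -- Here `f k` stands for ζ^k. Primitivity takes the form `f-cancel`, that 1 - ζ^k is not a zero
  -- divisor for 0 < k < t; each vanishing below then comes from a fixed-point equation, without
  -- division.
  module RootsOfUnity
    (f : ℕ → Carrier) (f-zero : f 0 ≈ 1#) (f-+ : ∀ m n → f (m ℕ.+ n) ≈ f m * f n)
    (t : ℕ) .{{_ : NonZero t}} (f-t : f t ≈ 1#)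
    (f-cancel : ∀ {k} → 0 ℕ.< k → k ℕ.< t → ∀ {y} → f k * y ≈ y → y ≈ 0#)
    where

    geometric : ℕ → ∀ n → Vec Carrier n
    geometric m zero    = []
    geometric m (suc n) = f m ∷ geometric (suc m) n

    geometric-tabulate : ∀ m n → Vec.tabulate {n = n} (λ i → f (m ℕ.+ toℕ i)) ≡ geometric m n
    geometric-tabulate m zero    = ≡.refl
    geometric-tabulate m (suc n) = ≡.cong₂ _∷_ (≡.cong f (ℕ.+-identityʳ m))
      (≡.trans (Vec.tabulate-cong (λ i → ≡.cong f (ℕ.+-suc m (toℕ i)))) (geometric-tabulate (suc m) n))

    hₖ-scale : ∀ m n k → hₖ (geometric (suc m) n) k ≈ f k * hₖ (geometric m n) k
    hₖ-scale m n zero = trans (hₖ-zero (geometric (suc m) n))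
      (sym (trans (*-cong f-zero (hₖ-zero (geometric m n))) (*-identityˡ 1#)))
    hₖ-scale m zero    (suc k) = sym (zeroʳ _)
    hₖ-scale m (suc n) (suc k) = begin
      hₖ (geometric (2 ℕ.+ m) n) (suc k) + f (suc m) * hₖ (geometric (suc m) (suc n)) k
        ≈⟨ +-cong (hₖ-scale (suc m) n (suc k)) (*-congˡ (hₖ-scale m (suc n) k)) ⟩
      f (suc k) * hₖ (geometric (suc m) n) (suc k) + f (suc m) * (f k * hₖ (geometric m (suc n)) k)
        ≈⟨ +-congˡ (trans (sym (*-assoc _ _ _)) (trans (*-congʳ (sym exchange)) (*-assoc _ _ _))) ⟩
      f (suc k) * hₖ (geometric (suc m) n) (suc k) + f (suc k) * (f m * hₖ (geometric m (suc n)) k)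
        ≈⟨ distribˡ _ _ _ ⟨
      f (suc k) * hₖ (geometric m (suc n)) (suc k) ∎
      where
      exchange : f (suc k) * f m ≈ f (suc m) * f k
      exchange = trans (sym (f-+ (suc k) m)) (trans (reflexive (≡.cong (f ∘ suc) (ℕ.+-comm k m))) (f-+ (suc m) k))

    -- By the two q-Pascal rules these are the Gaussian binomial coefficients
    -- [n + k - 1 choose k] at q = f 1.
    G : ℕ → ℕ → Carrier
    G n = hₖ (geometric 0 n)

    G-first : ∀ n k → G (suc n) (suc k) ≈ f (suc k) * G n (suc k) + G (suc n) k
    G-first n k = +-cong (hₖ-scale 0 n (suc k)) (trans (*-congʳ f-zero) (*-identityˡ _))

    -- The recursion of `hₖ` peels off the first variable, this rule the last one, `f n`. A double
    -- induction through `G-first` gives it without a proof that `hₖ` is symmetric.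
    G-last : ∀ n k → G (suc n) (suc k) ≈ G n (suc k) + f n * G (suc n) k
    G-last zero    k = refl
    G-last (suc n) zero = begin
      G (2 ℕ.+ n) 1                              ≈⟨ G-first (suc n) 0 ⟩
      f 1 * G (suc n) 1 + 1#                     ≈⟨ +-congʳ (*-congˡ (G-last n 0)) ⟩
      f 1 * (G n 1 + f n * 1#) + 1#              ≈⟨ solve 3 (λ a b c → a :* (b :+ c :* :1) :+ :1 := a :* b :+ :1 :+ a :* c :* :1) refl _ _ _ ⟩
      f 1 * G n 1 + 1# + f 1 * f n * 1#          ≈⟨ +-cong (G-first n 0) (*-congʳ (f-+ 1 n)) ⟨
      G (suc n) 1 + f (suc n) * 1#               ∎
    G-last (suc n) (suc k) = begin
      G (2 ℕ.+ n) (2 ℕ.+ k)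
        ≈⟨ G-first (suc n) (suc k) ⟩
      f (2 ℕ.+ k) * G (suc n) (2 ℕ.+ k) + G (2 ℕ.+ n) (suc k)
        ≈⟨ +-cong (*-cong (f-+ 1 (suc k)) (G-last n (suc k))) (G-last (suc n) k) ⟩
      f 1 * f (suc k) * (G n (2 ℕ.+ k) + f n * G (suc n) (suc k)) + (G (suc n) (suc k) + f (suc n) * G (2 ℕ.+ n) k)
        ≈⟨ +-congˡ (+-congˡ (*-congʳ (f-+ 1 n))) ⟩
      f 1 * f (suc k) * (G n (2 ℕ.+ k) + f n * G (suc n) (suc k)) + (G (suc n) (suc k) + f 1 * f n * G (2 ℕ.+ n) k)
        ≈⟨ solve 6 (λ q qk qn a b c → q :* qk :* (a :+ qn :* b) :+ (b :+ q :* qn :* c)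
             := q :* qk :* a :+ b :+ q :* qn :* (qk :* b :+ c)) refl _ _ _ _ _ _ ⟩
      f 1 * f (suc k) * G n (2 ℕ.+ k) + G (suc n) (suc k) + f 1 * f n * (f (suc k) * G (suc n) (suc k) + G (2 ℕ.+ n) k)
        ≈⟨ +-cong (trans (G-first n (suc k)) (+-congʳ (*-congʳ (f-+ 1 (suc k))))) (*-cong (f-+ 1 n) (G-first (suc n) k)) ⟨
      G (suc n) (2 ℕ.+ k) + f (suc n) * G (2 ℕ.+ n) (suc k) ∎

    -- The two Pascal rules compute the same value. If `n = t`, then `f n = 1` and the terms
    -- `G (suc n) k` cancel; if `f (suc k) = 1`, the terms `G n (suc k)` cancel. Either way a
    -- fixed-point equation for `f-cancel` is left.
    G-exchange : ∀ n k → f (suc k) * G n (suc k) + G (suc n) k ≈ G n (suc k) + f n * G (suc n) k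
    G-exchange n k = trans (sym (G-first n k)) (G-last n k)

    f-multiple : ∀ m → f (m ℕ.* t) ≈ 1#
    f-multiple zero    = f-zero
    f-multiple (suc m) = trans (f-+ t (m ℕ.* t)) (trans (*-cong f-t (f-multiple m)) (*-identityˡ 1#))

    f-remainder : ∀ m r → f (m ℕ.* t ℕ.+ r) ≈ f r
    f-remainder m r = trans (f-+ (m ℕ.* t) r) (trans (*-congʳ (f-multiple m)) (*-identityˡ _))

    e : ℕ → Carrier
    e = G t

    e-nonmultiple : ∀ m {r} → 0 ℕ.< r → r ℕ.< t → e (m ℕ.* t ℕ.+ r) ≈ 0#
    e-nonmultiple m {suc r} 0<r r<t = f-cancel 0<r r<t (trans (*-congʳ (sym (f-remainder m (suc r)))) fixed)
      where
      fixed : f (m ℕ.* t ℕ.+ suc r) * e (m ℕ.* t ℕ.+ suc r) ≈ e (m ℕ.* t ℕ.+ suc r)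
      fixed rewrite ℕ.+-suc (m ℕ.* t) r = ∙-cancelʳ (G (suc t) k) _ _
        (trans (G-exchange t k) (+-congˡ (trans (*-congʳ f-t) (*-identityˡ _))))
        where
        k = m ℕ.* t ℕ.+ r
        open import Algebra.Properties.AbelianGroup +-abelianGroup using (∙-cancelʳ)

    G-one : ∀ k → G 1 k ≈ 1#
    G-one zero    = refl
    G-one (suc k) = trans (+-identityˡ _) (trans (*-cong f-zero (G-one k)) (*-identityˡ 1#))

    -- With the single variable 1 the value is 1, and in a degree where ζ^k = 1 each further
    -- variable, up to ζ^(t-1), contributes zero.
    G-periodic : ∀ {k} → f (suc k) ≈ 1# → ∀ n → n ℕ.< t → G (suc n) (suc k) ≈ 1#
    G-periodic {k} fk≈1 zero    _   = G-one (suc k)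
    G-periodic {k} fk≈1 (suc n) n<t = begin
      G (2 ℕ.+ n) (suc k)                             ≈⟨ G-last (suc n) k ⟩
      G (suc n) (suc k) + f (suc n) * G (2 ℕ.+ n) k   ≈⟨ +-cong (G-periodic fk≈1 n (ℕ.<-trans (ℕ.n<1+n n) n<t))
                                                          (trans (*-congˡ vanish) (zeroʳ _)) ⟩
      1# + 0#                                         ≈⟨ +-identityʳ 1# ⟩
      1#                                              ∎
      where
      vanish : G (2 ℕ.+ n) k ≈ 0#
      vanish = f-cancel z<s n<t (sym (∙-cancelˡ (G (suc n) (suc k)) _ _
        (trans (+-congʳ (sym (trans (*-congʳ fk≈1) (*-identityˡ _)))) (G-exchange (suc n) k))))

    e-multiple : ∀ m → e (m ℕ.* t) ≈ 1#
    e-multiple zero    = hₖ-zero (geometric 0 t)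
    e-multiple (suc m) = aux t ≡.refl
      where
      aux : ∀ s → s ≡ t → G s (t ℕ.+ m ℕ.* t) ≈ 1#
      aux zero    s≡t with () ← ≡.subst NonZero (≡.sym s≡t) (ℕ.≢-nonZero (ℕ.≢-nonZero⁻¹ t))
      aux (suc s) ≡.refl = G-periodic (f-multiple (suc m)) s ℕ.≤-refl

    e-period : ∀ k → e (t ℕ.+ k) ≈ e k
    e-period k = ≡.subst (λ j → e (t ℕ.+ j) ≈ e j)
      (≡.sym (≡.trans (m≡m%n+[m/n]*n k t) (ℕ.+-comm (k % t) _))) (aux (k / t) (k % t) (m%n<n k t))
      where
      aux : ∀ m r → r ℕ.< t → e (t ℕ.+ (m ℕ.* t ℕ.+ r)) ≈ e (m ℕ.* t ℕ.+ r)
      aux m r r<t rewrite ≡.sym (ℕ.+-assoc t (m ℕ.* t) r) with r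
      ... | zero rewrite ℕ.+-identityʳ (t ℕ.+ m ℕ.* t) | ℕ.+-identityʳ (m ℕ.* t) =
        trans (e-multiple (suc m)) (sym (e-multiple m))
      ... | suc _ = trans (e-nonmultiple (suc m) z<s r<t) (sym (e-nonmultiple m z<s r<t))

    module _ {n} (ys : Vec Carrier n) where

      -- The degree is `k - 1 < t`, so only `e 0 = 1` contributes to the Cauchy product. The case
      -- `k = t` matters: the Jacobi-Trudi determinant involves `suc r` for a residue `r`, which may
      -- be `t`.
      h₋₁-roots-small : ∀ {k} → k ℕ.≤ t → h₋₁ (geometric 0 t Vec.++ ys) k ≈ h₋₁ ys k
      h₋₁-roots-small {zero}  _   = refl
      h₋₁-roots-small {suc k} k<t = trans (hₖ-++ (geometric 0 t) ys k)
        (⋆-identity (hₖ ys) k (hₖ-zero (geometric 0 t))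
          (λ j j<k → e-nonmultiple 0 z<s (ℕ.≤-<-trans j<k k<t)))

      -- The roots of unity multiply the generating series by 1/(1 - T^t); this is the resulting
      -- equation after multiplication by 1 - T^t.
      h₋₁-roots-period : ∀ k → h₋₁ (geometric 0 t Vec.++ ys) (t ℕ.+ k) ≈ h₋₁ ys (t ℕ.+ k) + h₋₁ (geometric 0 t Vec.++ ys) k
      h₋₁-roots-period zero    rewrite ℕ.+-identityʳ t = trans (h₋₁-roots-small ℕ.≤-refl) (sym (+-identityʳ _))
      h₋₁-roots-period (suc k) rewrite ℕ.+-suc t k = trans (hₖ-++ (geometric 0 t) ys (t ℕ.+ k))
         (trans (split t ≡.refl) (+-congˡ (sym (hₖ-++ (geometric 0 t) ys k))))
        where
        split : ∀ s → s ≡ t → (e ⋆ hₖ ys) (s ℕ.+ k) ≈ hₖ ys (s ℕ.+ k) + (e ⋆ hₖ ys) k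
        split zero    s≡t with () ← ≡.subst NonZero (≡.sym s≡t) (ℕ.≢-nonZero (ℕ.≢-nonZero⁻¹ t))
        split (suc s) ≡.refl = +-cong
          (trans (*-congʳ (hₖ-zero (geometric 0 t))) (*-identityˡ _))
          (trans (⋆-zeroes s (λ j j<s → e-nonmultiple 0 z<s (s<s j<s)) (hₖ ys) k)
                 (⋆-congʳ e-period (hₖ ys) k))

      h₋₁-roots : ∀ m {r} → r ℕ.≤ t →
        h₋₁ (geometric 0 t Vec.++ ys) (m ℕ.* t ℕ.+ r) ≈ progressionSum t (h₋₁ ys) m r
      h₋₁-roots zero    r≤t = h₋₁-roots-small r≤t
      h₋₁-roots (suc m) {r} r≤t rewrite ℕ.+-assoc t (m ℕ.* t) r =
        trans (h₋₁-roots-period (m ℕ.* t ℕ.+ r)) (+-congˡ (h₋₁-roots m r≤t))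

-- Laurent polynomials

module LaurentRing {c ℓ} (K : CommutativeRing c ℓ) where
  open CommutativeRing K hiding (zero)
  open import Data.Integer using (+_)
  open RingSolver K
  open JacobiTrudi K
  open Laurent (Semiring.rawSemiring semiring)
  open import Algebra.Properties.Ring ring using (-0#≈0#)
  open import Algebra.Properties.AbelianGroup +-abelianGroup using (⁻¹-∙-comm)
  open import Algebra.Definitions.RawMonoid +-rawMonoid using () renaming (_×_ to _·_)
  open import Relation.Binary.Reasoning.Setoid setoid

  private
    infixl 7 _∙_
    _∙_ : Laurent → Laurent → Laurent
    _∙_ = RawSemiring._*_ laurent

    δ : ℤ → ℤ → Carrier
    δ k e = ⟪ does (e ℤ.≟ k) ⟫

    -- While `coeff` branches on an equality of exponents, pairing with a function on exponents is a
    -- weighted sum, to which the rules for `lsum` apply.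
    ⟨_,_⟩ : Laurent → (ℤ → Carrier) → Carrier
    ⟨ p , φ ⟩ = lsum (λ (a , e) → a * φ e) p

  coeff-pairing : ∀ p k → coeff p k ≈ ⟨ p , δ k ⟩
  coeff-pairing []            k = refl
  coeff-pairing ((a , e) ∷ p) k with e ℤ.≟ k
  ... | yes _ = +-cong (sym (*-identityʳ a)) (coeff-pairing p k)
  ... | no  _ =
    trans (coeff-pairing p k) (sym (trans (+-congʳ (zeroʳ a)) (+-identityˡ _)))

  coeff-++ : ∀ p q k → coeff (p ++ q) k ≈ coeff p k + coeff q k
  coeff-++ p q k = trans (coeff-pairing (p ++ q) k) (trans (lsum-++ _ p q)
    (sym (+-cong (coeff-pairing p k) (coeff-pairing q k))))

  negate : Laurent → Laurent
  negate = map (λ (a , e) → - a , e)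

  coeff-negate : ∀ p k → coeff (negate p) k ≈ - coeff p k
  coeff-negate []            k = sym -0#≈0#
  coeff-negate ((a , e) ∷ p) k with e ℤ.≟ k
  ... | yes _ = trans (+-congˡ (coeff-negate p k)) (⁻¹-∙-comm _ _)
  ... | no  _ = coeff-negate p k

  pairing-∙ : ∀ p q φ → ⟨ p ∙ q , φ ⟩ ≈ lsum (λ (a , e) → lsum (λ (b , f) → a * b * φ (e ℤ.+ f)) q) p
  pairing-∙ p q φ = lsum-product (λ (a , e) → a * φ e) _ p q

  δ-shift : ∀ k e f → δ k (e ℤ.+ f) ≡ δ (k ℤ.- e) f
  δ-shift k e f with f ℤ.≟ k ℤ.- e
  ... | yes ≡.refl = ≡.cong ⟪_⟫ (dec-true (e ℤ.+ f ℤ.≟ k)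
          (≡.trans (ℤ.+-comm e (k ℤ.- e)) (≡.trans (ℤ.+-assoc k (ℤ.- e) e)
            (≡.trans (≡.cong (λ i → k ℤ.+ i) (ℤ.+-inverseˡ e)) (ℤ.+-identityʳ k)))))
  ... | no f≢ = ≡.cong ⟪_⟫ (dec-false (e ℤ.+ f ℤ.≟ k) λ { ≡.refl → f≢
          (≡.sym (≡.trans (≡.cong (λ i → i ℤ.- e) (ℤ.+-comm e f)) (≡.trans (ℤ.+-assoc f e (ℤ.- e))
            (≡.trans (≡.cong (λ i → f ℤ.+ i) (ℤ.+-inverseʳ e)) (ℤ.+-identityʳ f))))) })

  -- Expanding the left factor alone shows that the product depends on `q` only through its
  -- coefficients. This makes multiplication respect `≈ᴸ` on the right, and commutativity transfers
  -- it to the left.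
  coeff-∙ : ∀ p q k → coeff (p ∙ q) k ≈ lsum (λ (a , e) → a * coeff q (k ℤ.- e)) p
  coeff-∙ p q k = trans (coeff-pairing (p ∙ q) k) (trans (pairing-∙ p q (δ k)) (lsum-cong (λ (a , e) → begin
    lsum (λ (b , f) → a * b * δ k (e ℤ.+ f)) q
      ≈⟨ lsum-cong (λ (b , f) → trans (*-assoc a b _) (*-congˡ (*-congˡ (reflexive (δ-shift k e f))))) q ⟩
    lsum (λ (b , f) → a * (b * δ (k ℤ.- e) f)) q
      ≈⟨ lsum-distribˡ a _ q ⟨
    a * ⟨ q , δ (k ℤ.- e) ⟩
      ≈⟨ *-congˡ (coeff-pairing q (k ℤ.- e)) ⟨
    a * coeff q (k ℤ.- e) ∎) p))

  lsum-comm : ∀ {a b} {A : Set a} {B : Set b} (f : A → B → Carrier) xs ys →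
    lsum (λ x → lsum (f x) ys) xs ≈ lsum (λ y → lsum (λ x → f x y) xs) ys
  lsum-comm f []       ys = sym (lsum-zero ys)
    where
    lsum-zero : ∀ {b} {B : Set b} (ys : List B) → lsum (λ _ → 0#) ys ≈ 0#
    lsum-zero []       = refl
    lsum-zero (y ∷ ys) = trans (+-identityˡ _) (lsum-zero ys)
  lsum-comm f (x ∷ xs) ys = trans (+-congˡ (lsum-comm f xs ys)) (sym (lsum-+ (f x) _ ys))
    where
    lsum-+ : ∀ {b} {B : Set b} (f g : B → Carrier) ys → lsum (λ y → f y + g y) ys ≈ lsum f ys + lsum g ys
    lsum-+ f g []       = sym (+-identityˡ 0#)
    lsum-+ f g (y ∷ ys) = trans (+-congˡ (lsum-+ f g ys))
      (solve 4 (λ a b c d → a :+ b :+ (c :+ d) := a :+ c :+ (b :+ d)) refl _ _ _ _)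

  ∙-comm : ∀ p q → (p ∙ q) ≈ᴸ (q ∙ p)
  ∙-comm p q k = begin
    coeff (p ∙ q) k
      ≈⟨ trans (coeff-pairing (p ∙ q) k) (pairing-∙ p q (δ k)) ⟩
    lsum (λ (a , e) → lsum (λ (b , f) → a * b * δ k (e ℤ.+ f)) q) p
      ≈⟨ lsum-comm _ p q ⟩
    lsum (λ (b , f) → lsum (λ (a , e) → a * b * δ k (e ℤ.+ f)) p) q
      ≈⟨ lsum-cong (λ (b , f) → lsum-cong (λ (a , e) → *-cong (*-comm a b) (reflexive (≡.cong (δ k) (ℤ.+-comm e f)))) p) q ⟩
    lsum (λ (b , f) → lsum (λ (a , e) → b * a * δ k (f ℤ.+ e)) p) q
      ≈⟨ trans (coeff-pairing (q ∙ p) k) (pairing-∙ q p (δ k)) ⟨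
    coeff (q ∙ p) k ∎

  ∙-congˡ : ∀ p {q r} → q ≈ᴸ r → (p ∙ q) ≈ᴸ (p ∙ r)
  ∙-congˡ p {q} {r} q≈r k = trans (coeff-∙ p q k)
    (trans (lsum-cong (λ (a , e) → *-congˡ (q≈r (k ℤ.- e))) p) (sym (coeff-∙ p r k)))

  ∙-cong : ∀ {p q r s} → p ≈ᴸ q → r ≈ᴸ s → (p ∙ r) ≈ᴸ (q ∙ s)
  ∙-cong {p} {q} {r} {s} p≈q r≈s k = begin
    coeff (p ∙ r) k  ≈⟨ ∙-congˡ p r≈s k ⟩
    coeff (p ∙ s) k  ≈⟨ ∙-comm p s k ⟩
    coeff (s ∙ p) k  ≈⟨ ∙-congˡ s p≈q k ⟩
    coeff (s ∙ q) k  ≈⟨ ∙-comm s q k ⟩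
    coeff (q ∙ s) k  ∎

  ∙-assoc : ∀ p q r → ((p ∙ q) ∙ r) ≈ᴸ (p ∙ (q ∙ r))
  ∙-assoc p q r k = begin
    coeff ((p ∙ q) ∙ r) k
      ≈⟨ trans (coeff-pairing ((p ∙ q) ∙ r) k) (pairing-∙ (p ∙ q) r (δ k)) ⟩
    lsum (λ (c , g) → lsum (λ (d , h) → c * d * δ k (g ℤ.+ h)) r) (p ∙ q)
      ≈⟨ lsum-product (λ (c , g) → lsum (λ (d , h) → c * d * δ k (g ℤ.+ h)) r) _ p q ⟩
    lsum (λ (a , e) → lsum (λ (b , f) → lsum (λ (d , h) → a * b * d * δ k (e ℤ.+ f ℤ.+ h)) r) q) p
      ≈⟨ lsum-cong (λ (a , e) → trans
           (lsum-cong (λ (b , f) → lsum-cong (λ (d , h) →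
             *-cong (*-assoc a b d) (reflexive (≡.cong (δ k) (ℤ.+-assoc e f h)))) r) q)
           (sym (lsum-product (λ (c , g) → a * c * δ k (e ℤ.+ g)) _ q r))) p ⟩
    lsum (λ (a , e) → lsum (λ (c , g) → a * c * δ k (e ℤ.+ g)) (q ∙ r)) p
      ≈⟨ trans (coeff-pairing (p ∙ (q ∙ r)) k) (pairing-∙ p (q ∙ r) (δ k)) ⟨
    coeff (p ∙ (q ∙ r)) k ∎

  coeff-const-∙ : ∀ a p k → coeff (const a ∙ p) k ≈ a * coeff p k
  coeff-const-∙ a p k = trans (coeff-∙ (const a) p k) (trans (+-identityʳ _)
    (*-congˡ (reflexive (≡.cong (coeff p) (ℤ.+-identityʳ k)))))

  ∙-identityˡ : ∀ p → (const 1# ∙ p) ≈ᴸ p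
  ∙-identityˡ p k = trans (coeff-const-∙ 1# p k) (*-identityˡ _)

  ∙-distribʳ : ∀ p q r → ((q ++ r) ∙ p) ≈ᴸ (q ∙ p ++ r ∙ p)
  ∙-distribʳ p q r k = begin
    coeff ((q ++ r) ∙ p) k                                      ≈⟨ coeff-∙ (q ++ r) p k ⟩
    lsum (λ (a , e) → a * coeff p (k ℤ.- e)) (q ++ r)           ≈⟨ lsum-++ _ q r ⟩
    _ + _                                                       ≈⟨ +-cong (coeff-∙ q p k) (coeff-∙ r p k) ⟨
    coeff (q ∙ p) k + coeff (r ∙ p) k                           ≈⟨ coeff-++ (q ∙ p) (r ∙ p) k ⟨
    coeff (q ∙ p ++ r ∙ p) k                                    ∎

  laurent-isCommutativeRing : IsCommutativeRing _≈ᴸ_ _++_ _∙_ negate [] (const 1#)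
  laurent-isCommutativeRing = record
    { isRing = record
      { +-isAbelianGroup = record
        { isGroup = record
          { isMonoid = record
            { isSemigroup = record
              { isMagma = record
                { isEquivalence = record
                  { refl = λ _ → refl ; sym = λ p≈q k → sym (p≈q k) ; trans = λ p≈q q≈r k → trans (p≈q k) (q≈r k) }
                ; ∙-cong = λ {p} {q} {r} {s} p≈q r≈s k → trans (coeff-++ p r k)
                    (trans (+-cong (p≈q k) (r≈s k)) (sym (coeff-++ q s k))) }
              ; assoc = λ p q r k → reflexive (≡.cong (λ s → coeff s k) (List.++-assoc p q r)) }
            ; identity = (λ p k → refl) , (λ p k → reflexive (≡.cong (λ s → coeff s k) (List.++-identityʳ p))) }
          ; inverse = (λ p k → trans (coeff-++ (negate p) p k) (trans (+-congʳ (coeff-negate p k)) (-‿inverseˡ _)))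
                    , (λ p k → trans (coeff-++ p (negate p) k) (trans (+-congˡ (coeff-negate p k)) (-‿inverseʳ _)))
          ; ⁻¹-cong = λ {p} {q} p≈q k → trans (coeff-negate p k) (trans (-‿cong (p≈q k)) (sym (coeff-negate q k))) }
        ; comm = λ p q k → trans (coeff-++ p q k) (trans (+-comm _ _) (sym (coeff-++ q p k))) }
      ; *-cong = λ {p} {q} {r} {s} → ∙-cong {p} {q} {r} {s}
      ; *-assoc = ∙-assoc
      ; *-identity = ∙-identityˡ , (λ p k → trans (∙-comm p (const 1#) k) (∙-identityˡ p k))
      ; distrib = (λ p q r k → begin
            coeff (p ∙ (q ++ r)) k                ≈⟨ ∙-comm p (q ++ r) k ⟩
            coeff ((q ++ r) ∙ p) k                ≈⟨ ∙-distribʳ p q r k ⟩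
            coeff (q ∙ p ++ r ∙ p) k              ≈⟨ coeff-++ (q ∙ p) (r ∙ p) k ⟩
            coeff (q ∙ p) k + coeff (r ∙ p) k     ≈⟨ +-cong (∙-comm q p k) (∙-comm r p k) ⟩
            coeff (p ∙ q) k + coeff (p ∙ r) k     ≈⟨ coeff-++ (p ∙ q) (p ∙ r) k ⟨
            coeff (p ∙ q ++ p ∙ r) k              ∎)
          , ∙-distribʳ }
    ; *-comm = ∙-comm }

  laurentRing : CommutativeRing _ _
  laurentRing = record { isCommutativeRing = laurent-isCommutativeRing }

  X Y : ℕ → Laurent
  X n = (1# , + n) ∷ []
  Y n = (1# , ℤ.- + n) ∷ []

  term-cong : ∀ {a b e f} → a ≈ b → e ≡ f → ((a , e) ∷ []) ≈ᴸ ((b , f) ∷ [])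
  term-cong {e = e} a≈b ≡.refl k with e ℤ.≟ k
  ... | yes _ = +-congʳ a≈b
  ... | no  _ = refl

  X-+ : ∀ m n → X (m ℕ.+ n) ≈ᴸ (X m ∙ X n)
  X-+ m n = term-cong {e = + (m ℕ.+ n)} (sym (*-identityˡ 1#)) ≡.refl

  Y-+ : ∀ m n → Y (m ℕ.+ n) ≈ᴸ (Y m ∙ Y n)
  Y-+ m n = term-cong (sym (*-identityˡ 1#)) (ℤ.neg-distrib-+ (+ m) (+ n))

  X∙Y : ∀ n → (X n ∙ Y n) ≈ᴸ const 1#
  X∙Y n = term-cong (*-identityˡ 1#) (ℤ.+-inverseʳ (+ n))

  ∑X : List ℕ → Laurent
  ∑X ns = foldr _++_ [] (map X ns)

  coeff-∑X : ∀ ns k → coeff (∑X ns) (+ k) ≈ length (filter (ℕ._≟ k) ns) · 1#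
  coeff-∑X []       k = refl
  coeff-∑X (n ∷ ns) k with + n ℤ.≟ + k
  ... | yes ≡.refl rewrite List.filter-accept (ℕ._≟ k) {x = n} {xs = ns} ≡.refl = +-congˡ (coeff-∑X ns k)
  ... | no  n≢k    rewrite List.filter-reject (ℕ._≟ k) {x = n} {xs = ns} (λ n≡k → n≢k (≡.cong (λ i → + i) n≡k)) = coeff-∑X ns k

  module _ (char0 : ∀ n → ¬ (suc n · 1# ≈ 0#)) where
    -- The coefficient at `k` is the multiplicity of `k` in the list, and characteristic zero keeps
    -- a positive multiplicity away from `0#`.
    ∑X-∈ : ∀ {es fs} → ∑X es ≈ᴸ ∑X fs → ∀ {k} → k ∈ es → k ∈ fs
    ∑X-∈ {es} {fs} es≈fs {k} k∈es with k ∈? fs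
    ... | yes k∈fs = k∈fs
    ... | no  k∉fs = contradiction positive (nonzero (∈-length (∈-filter⁺ (ℕ._≟ k) k∈es ≡.refl)))
      where
      nonzero : ∀ {n} → 0 ℕ.< n → ¬ (n · 1# ≈ 0#)
      nonzero {suc n} _ = char0 n
      empty : filter (ℕ._≟ k) fs ≡ []
      empty = List.filter-none (ℕ._≟ k) (All.map (λ k≢n n≡k → k≢n (≡.sym n≡k)) (All.¬Any⇒All¬ fs k∉fs))
      positive : length (filter (ℕ._≟ k) es) · 1# ≈ 0#
      positive = trans (sym (coeff-∑X es k)) (trans (es≈fs (+ k)) (trans (coeff-∑X fs k)
        (reflexive (≡.cong (λ ns → length ns · 1#) empty))))

-- Comparison of exponents

open import Data.Nat.ListAction using (sum)

-- The exponents of the positive and of the negative terms of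
--   (z^r − z^{t+A}) (z^s − z^{t+B}) (z^{A+r} − z^{B+s}) − (1 − z^t)² z^{r+s} (z^{2A} − z^{2B}).
positiveExponents negativeExponents : (t r s A B : ℕ) → List ℕ
positiveExponents t r s A B = map sum
  ((r ∷ s ∷ B ∷ B ∷ []) ∷ (r ∷ r ∷ s ∷ A ∷ []) ∷ (t ∷ A ∷ s ∷ s ∷ B ∷ []) ∷
   (t ∷ t ∷ A ∷ A ∷ B ∷ r ∷ []) ∷ (r ∷ s ∷ t ∷ t ∷ B ∷ B ∷ []) ∷ (r ∷ s ∷ t ∷ A ∷ A ∷ []) ∷ [])
negativeExponents t r s A B = map sum
  ((r ∷ s ∷ s ∷ B ∷ []) ∷ (r ∷ r ∷ t ∷ B ∷ A ∷ []) ∷ (t ∷ t ∷ A ∷ B ∷ B ∷ s ∷ []) ∷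
   (r ∷ s ∷ A ∷ A ∷ []) ∷ (r ∷ s ∷ t ∷ t ∷ A ∷ A ∷ []) ∷ (r ∷ s ∷ t ∷ B ∷ B ∷ []) ∷ [])

-- Because r, s < t and B < A, the negative exponents other than r + 2s + B all exceed r + s + 2B;
-- equality with r + 2s + B means s = B.
lowest-exponent : ∀ {t r s A B} → r ℕ.< t → s ℕ.< t → B ℕ.< A →
  sum (r ∷ s ∷ B ∷ B ∷ []) ∈ negativeExponents t r s A B →
  s ≡ B
lowest-exponent {t} {r} {s} {A} {B} r<t s<t B<A = λ {
    (here eq) → ≡.sym (ℕ.+-cancelˡ-≡ (r ℕ.+ s ℕ.+ B) B s (≡.trans (lhs r s B) (≡.trans eq (c₁ r s B))))
  ; (there (here eq)) → contradiction
    (≡.trans (l₂ r s B) (≡.trans eq (c₂ r t A B)))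
    (ℕ.<⇒≢ (ℕ.+-monoʳ-< (r ℕ.+ B) (ℕ.<-≤-trans (ℕ.+-mono-< s<t B<A) (ℕ.m≤n+m (t ℕ.+ A) r))))
  ; (there (there (here eq))) → contradiction
    (≡.trans (l₃ r s B) (≡.trans eq (c₃ t A B s)))
    (ℕ.<⇒≢ (ℕ.+-monoʳ-< (s ℕ.+ B ℕ.+ B) (ℕ.<-≤-trans r<t (ℕ.m≤m+n t (t ℕ.+ A)))))
  ; (there (there (there (here eq)))) → contradiction
    (≡.trans (l₄ r s B) (≡.trans eq (≡.sym (l₄ r s A))))
    (ℕ.<⇒≢ (ℕ.+-monoʳ-< (r ℕ.+ s) (ℕ.+-mono-< B<A B<A)))
  ; (there (there (there (there (here eq))))) → contradiction
    (≡.trans (l₄ r s B) (≡.trans eq (c₅ r s t A)))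
    (ℕ.<⇒≢ (ℕ.+-monoʳ-< (r ℕ.+ s) (ℕ.<-≤-trans (ℕ.+-mono-< B<A B<A) (ℕ.m≤m+n (A ℕ.+ A) (t ℕ.+ t)))))
  ; (there (there (there (there (there (here eq)))))) → contradiction
    (≡.trans (l₆ r s B) (≡.trans eq (c₆ r s t B)))
    (ℕ.<⇒≢ (ℕ.+-monoʳ-< (r ℕ.+ s ℕ.+ B ℕ.+ B) (ℕ.≤-<-trans ℕ.z≤n r<t))) }
  where
  lhs : ∀ r s B → r ℕ.+ s ℕ.+ B ℕ.+ B ≡ r ℕ.+ (s ℕ.+ (B ℕ.+ (B ℕ.+ 0)))
  lhs = solve-∀
  c₁ : ∀ r s B → r ℕ.+ (s ℕ.+ (s ℕ.+ (B ℕ.+ 0))) ≡ r ℕ.+ s ℕ.+ B ℕ.+ s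
  c₁ = solve-∀
  l₂ : ∀ r s B → r ℕ.+ B ℕ.+ (s ℕ.+ B) ≡ r ℕ.+ (s ℕ.+ (B ℕ.+ (B ℕ.+ 0)))
  l₂ = solve-∀
  c₂ : ∀ r t A B → r ℕ.+ (r ℕ.+ (t ℕ.+ (B ℕ.+ (A ℕ.+ 0)))) ≡ r ℕ.+ B ℕ.+ (r ℕ.+ (t ℕ.+ A))
  c₂ = solve-∀
  l₃ : ∀ r s B → s ℕ.+ B ℕ.+ B ℕ.+ r ≡ r ℕ.+ (s ℕ.+ (B ℕ.+ (B ℕ.+ 0)))
  l₃ = solve-∀
  c₃ : ∀ t A B s → t ℕ.+ (t ℕ.+ (A ℕ.+ (B ℕ.+ (B ℕ.+ (s ℕ.+ 0))))) ≡ s ℕ.+ B ℕ.+ B ℕ.+ (t ℕ.+ (t ℕ.+ A))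
  c₃ = solve-∀
  l₄ : ∀ r s B → r ℕ.+ s ℕ.+ (B ℕ.+ B) ≡ r ℕ.+ (s ℕ.+ (B ℕ.+ (B ℕ.+ 0)))
  l₄ = solve-∀
  c₅ : ∀ r s t A → r ℕ.+ (s ℕ.+ (t ℕ.+ (t ℕ.+ (A ℕ.+ (A ℕ.+ 0))))) ≡ r ℕ.+ s ℕ.+ (A ℕ.+ A ℕ.+ (t ℕ.+ t))
  c₅ = solve-∀
  l₆ : ∀ r s B → r ℕ.+ s ℕ.+ B ℕ.+ B ℕ.+ 0 ≡ r ℕ.+ (s ℕ.+ (B ℕ.+ (B ℕ.+ 0)))
  l₆ = solve-∀
  c₆ : ∀ r s t B → r ℕ.+ (s ℕ.+ (t ℕ.+ (B ℕ.+ (B ℕ.+ 0)))) ≡ r ℕ.+ s ℕ.+ B ℕ.+ B ℕ.+ t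
  c₆ = solve-∀

-- Once s = B, the first exponents of the two lists coincide, and both are dropped. Of the five
-- negative exponents left, three exceed 2r + A + B because r < t; equality with r + B + 2A or r + t
-- + 3B gives the two alternatives.
next-exponent : ∀ {t r A B} → r ℕ.< t →
  sum (r ∷ r ∷ B ∷ A ∷ []) ∈ drop 1 (negativeExponents t r B A B) →
  A ≡ r ⊎ A ℕ.+ r ≡ t ℕ.+ (B ℕ.+ B)
next-exponent {t} {r} {A} {B} r<t = λ {
    (here eq) → contradiction (≡.trans (l₁ r B A) (≡.trans eq (c₁ r t B A)))
    (ℕ.<⇒≢ (ℕ.+-monoʳ-< (r ℕ.+ r ℕ.+ B ℕ.+ A) (ℕ.≤-<-trans ℕ.z≤n r<t)))
  ; (there (here eq)) → contradiction (≡.trans (l₂ r B A) (≡.trans eq (c₂ t A B)))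
    (ℕ.<⇒≢ (ℕ.+-monoʳ-< (A ℕ.+ B) (ℕ.<-≤-trans (ℕ.+-mono-< r<t r<t) (ℕ.m≤m+n (t ℕ.+ t) (B ℕ.+ B)))))
  ; (there (there (here eq))) → inj₁ (≡.sym (ℕ.+-cancelˡ-≡ (r ℕ.+ B ℕ.+ A) r A (≡.trans (l₃ r B A) (≡.trans eq (c₃ r B A)))))
  ; (there (there (there (here eq)))) → contradiction (≡.trans (l₃ r B A) (≡.trans eq (c₄ r B t A)))
    (ℕ.<⇒≢ (ℕ.+-monoʳ-< (r ℕ.+ B ℕ.+ A) (ℕ.<-≤-trans r<t (ℕ.m≤m+n t (t ℕ.+ A)))))
  ; (there (there (there (there (here eq))))) → inj₂ (ℕ.+-cancelˡ-≡ (r ℕ.+ B) (A ℕ.+ r) (t ℕ.+ (B ℕ.+ B)) (≡.trans (l₅ r B A) (≡.trans eq (c₅ r B t)))) }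
  where
  l₁ : ∀ r B A → r ℕ.+ r ℕ.+ B ℕ.+ A ℕ.+ 0 ≡ r ℕ.+ (r ℕ.+ (B ℕ.+ (A ℕ.+ 0)))
  l₁ = solve-∀
  c₁ : ∀ r t B A → r ℕ.+ (r ℕ.+ (t ℕ.+ (B ℕ.+ (A ℕ.+ 0)))) ≡ r ℕ.+ r ℕ.+ B ℕ.+ A ℕ.+ t
  c₁ = solve-∀
  l₂ : ∀ r B A → A ℕ.+ B ℕ.+ (r ℕ.+ r) ≡ r ℕ.+ (r ℕ.+ (B ℕ.+ (A ℕ.+ 0)))
  l₂ = solve-∀
  c₂ : ∀ t A B → t ℕ.+ (t ℕ.+ (A ℕ.+ (B ℕ.+ (B ℕ.+ (B ℕ.+ 0))))) ≡ A ℕ.+ B ℕ.+ (t ℕ.+ t ℕ.+ (B ℕ.+ B))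
  c₂ = solve-∀
  l₃ : ∀ r B A → r ℕ.+ B ℕ.+ A ℕ.+ r ≡ r ℕ.+ (r ℕ.+ (B ℕ.+ (A ℕ.+ 0)))
  l₃ = solve-∀
  c₃ : ∀ r B A → r ℕ.+ (B ℕ.+ (A ℕ.+ (A ℕ.+ 0))) ≡ r ℕ.+ B ℕ.+ A ℕ.+ A
  c₃ = solve-∀
  c₄ : ∀ r B t A → r ℕ.+ (B ℕ.+ (t ℕ.+ (t ℕ.+ (A ℕ.+ (A ℕ.+ 0))))) ≡ r ℕ.+ B ℕ.+ A ℕ.+ (t ℕ.+ (t ℕ.+ A))
  c₄ = solve-∀
  l₅ : ∀ r B A → r ℕ.+ B ℕ.+ (A ℕ.+ r) ≡ r ℕ.+ (r ℕ.+ (B ℕ.+ (A ℕ.+ 0)))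
  l₅ = solve-∀
  c₅ : ∀ r B t → r ℕ.+ (B ℕ.+ (t ℕ.+ (B ℕ.+ (B ℕ.+ 0)))) ≡ r ℕ.+ B ℕ.+ (t ℕ.+ (B ℕ.+ B))
  c₅ = solve-∀

-- Two-by-two determinants of geometric sums

module Wedge {c ℓ} (R : CommutativeRing c ℓ) where
  open CommutativeRing R hiding (zero)
  open RingSolver R
  open JacobiTrudi R using (lsum)
  open CompleteHomogeneous R
  open import Algebra.Properties.AbelianGroup +-abelianGroup using (∙-cancelˡ)
  open import Relation.Binary.Reasoning.Setoid setoid

  module Monomials
    (X Y : ℕ → Carrier) (X₀ : X 0 ≈ 1#) (Y₀ : Y 0 ≈ 1#)
    (X-+ : ∀ m n → X (m ℕ.+ n) ≈ X m * X n) (Y-+ : ∀ m n → Y (m ℕ.+ n) ≈ Y m * Y n)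
    (X*Y : ∀ n → X n * Y n ≈ 1#)
    where

    z z⁻¹ : Carrier
    z   = X 1
    z⁻¹ = Y 1

    U : ℕ → Carrier
    U = h₋₁ (z ∷ z⁻¹ ∷ [])

    hₖ-single : ∀ k → hₖ (z⁻¹ ∷ []) k ≈ Y k
    hₖ-single zero    = sym Y₀
    hₖ-single (suc k) = trans (+-identityˡ _) (trans (*-congˡ (hₖ-single k)) (sym (Y-+ 1 k)))

    U-sucˡ : ∀ n → U (suc n) ≈ z * U n + Y n
    U-sucˡ zero    = trans (sym Y₀) (sym (trans (+-congʳ (zeroʳ z)) (+-identityˡ _)))
    U-sucˡ (suc n) = trans (+-congʳ (hₖ-single (suc n))) (+-comm _ _)

    U-sucʳ : ∀ n → U (suc n) ≈ z⁻¹ * U n + X n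
    U-sucʳ zero    = trans (sym X₀) (sym (trans (+-congʳ (zeroʳ z⁻¹)) (+-identityˡ _)))
    U-sucʳ (suc n) = begin
      U (2 ℕ.+ n)                              ≈⟨ U-sucˡ (suc n) ⟩
      z * U (suc n) + Y (suc n)                ≈⟨ +-cong (*-congˡ (U-sucʳ n)) (Y-+ 1 n) ⟩
      z * (z⁻¹ * U n + X n) + z⁻¹ * Y n        ≈⟨ solve 5 (λ z z′ u x y → z :* (z′ :* u :+ x) :+ z′ :* y := z′ :* (z :* u :+ y) :+ z :* x) refl _ _ _ _ _ ⟩
      z⁻¹ * (z * U n + Y n) + z * X n          ≈⟨ +-cong (*-congˡ (U-sucˡ n)) (X-+ 1 n) ⟨
      z⁻¹ * U (suc n) + X (suc n)              ∎

    U-rec : ∀ n → U (2 ℕ.+ n) + U n ≈ (z + z⁻¹) * U (suc n)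
    U-rec n = begin
      U (2 ℕ.+ n) + U n                                  ≈⟨ +-cong (U-sucʳ (suc n)) (sym (trans (*-congʳ (X*Y 1)) (*-identityˡ _))) ⟩
      z⁻¹ * U (suc n) + X (suc n) + z * z⁻¹ * U n         ≈⟨ +-congʳ (+-congˡ (X-+ 1 n)) ⟩
      z⁻¹ * U (suc n) + z * X n + z * z⁻¹ * U n           ≈⟨ solve 5 (λ z z′ u v x → z′ :* u :+ z :* x :+ z :* z′ :* v := z′ :* u :+ z :* (z′ :* v :+ x)) refl _ _ _ _ _ ⟩
      z⁻¹ * U (suc n) + z * (z⁻¹ * U n + X n)             ≈⟨ +-congˡ (*-congˡ (U-sucʳ n)) ⟨
      z⁻¹ * U (suc n) + z * U (suc n)                     ≈⟨ trans (+-comm _ _) (sym (distribʳ _ _ _)) ⟩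
      (z + z⁻¹) * U (suc n)                               ∎

    F : ℕ → ℕ → Carrier
    F p q = U p * U (suc q) - U (suc p) * U q

    -- `F` is the Casoratian of two shifts of `U`, a solution of a recurrence whose companion matrix
    -- has determinant 1. The invariance takes the place of the formula `U_{p-q}`, which would need
    -- negative indices.
    F-suc : ∀ p q → F (suc p) (suc q) ≈ F p q
    F-suc p q = begin
      F (suc p) (suc q)
        ≈⟨ solve 6 (λ a b c d e f → b :* f :- c :* e := b :* (f :+ d) :- (c :+ a) :* e :+ (a :* e :- b :* d)) refl
             (U p) (U (suc p)) (U (2 ℕ.+ p)) (U q) (U (suc q)) (U (2 ℕ.+ q)) ⟩
      U (suc p) * (U (2 ℕ.+ q) + U q) - (U (2 ℕ.+ p) + U p) * U (suc q) + F p q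
        ≈⟨ +-congʳ (+-cong (*-congˡ (U-rec q)) (-‿cong (*-congʳ (U-rec p)))) ⟩
      U (suc p) * ((z + z⁻¹) * U (suc q)) - (z + z⁻¹) * U (suc p) * U (suc q) + F p q
        ≈⟨ solve 4 (λ a b c d → a :* (b :* c) :- b :* a :* c :+ d := d) refl _ _ _ _ ⟩
      F p q ∎

    F-shift : ∀ r p q → F (r ℕ.+ p) (r ℕ.+ q) ≈ F p q
    F-shift zero    p q = refl
    F-shift (suc r) p q = trans (F-suc (r ℕ.+ p) (r ℕ.+ q)) (F-shift r p q)

    -- The two relations for `c` say that (z - z⁻¹) c = x - y, and likewise for `d`. They are
    -- linear, so they hold for sums of values of `U` over a progression as well as for `U`: one
    -- computation serves both sides of the identity, and the double sum is never expanded.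
    wedge : ∀ c c⁺ x y d d⁺ u v →
      c⁺ ≈ z * c + y → c⁺ ≈ z⁻¹ * c + x → d⁺ ≈ z * d + v → d⁺ ≈ z⁻¹ * d + u →
      (z - z⁻¹) * (c * d⁺ - c⁺ * d) ≈ x * v - y * u
    wedge c c⁺ x y d d⁺ u v c⁺≈₁ c⁺≈₂ d⁺≈₁ d⁺≈₂ = begin
      (z - z⁻¹) * (c * d⁺ - c⁺ * d)
        ≈⟨ *-congˡ (+-cong (*-congˡ d⁺≈₁) (-‿cong (*-congʳ c⁺≈₁))) ⟩
      (z - z⁻¹) * (c * (z * d + v) - (z * c + y) * d)
        ≈⟨ solve 6 (λ z z′ c d v y → (z :- z′) :* (c :* (z :* d :+ v) :- (z :* c :+ y) :* d)
             := (z :- z′) :* c :* v :- y :* ((z :- z′) :* d)) refl _ _ _ _ _ _ ⟩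
      (z - z⁻¹) * c * v - y * ((z - z⁻¹) * d)
        ≈⟨ +-cong (*-congʳ (difference c⁺≈₁ c⁺≈₂)) (-‿cong (*-congˡ (difference d⁺≈₁ d⁺≈₂))) ⟩
      (x - y) * v - y * (u - v)
        ≈⟨ solve 4 (λ x y u v → (x :- y) :* v :- y :* (u :- v) := x :* v :- y :* u) refl _ _ _ _ ⟩
      x * v - y * u ∎
      where
      difference : ∀ {c c⁺ x y} → c⁺ ≈ z * c + y → c⁺ ≈ z⁻¹ * c + x → (z - z⁻¹) * c ≈ x - y
      difference {c} {c⁺} {x} {y} eq₁ eq₂ = begin
        (z - z⁻¹) * c                             ≈⟨ solve 4 (λ z z′ c y → (z :- z′) :* c := z :* c :+ y :- (z′ :* c :+ y)) refl _ _ _ y ⟩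
        z * c + y - (z⁻¹ * c + y)                 ≈⟨ +-congʳ (trans (sym eq₁) eq₂) ⟩
        z⁻¹ * c + x - (z⁻¹ * c + y)               ≈⟨ solve 3 (λ c x y → c :+ x :- (c :+ y) := x :- y) refl _ _ _ ⟩
        x - y                                     ∎

    module Progressions (t : ℕ) where

      private
        𝕊 : (ℕ → Carrier) → ℕ → ℕ → Carrier
        𝕊 = progressionSum t

      𝕊-suc : ∀ w {g} → (∀ n → U (suc n) ≈ w * U n + g n) → ∀ m r → 𝕊 U m (suc r) ≈ w * 𝕊 U m r + 𝕊 g m r
      𝕊-suc w {g} eq zero    r = eq r
      𝕊-suc w {g} eq (suc m) r rewrite ℕ.+-suc (suc m ℕ.* t) r = trans (+-cong (eq _) (𝕊-suc w eq m r))
        (solve 5 (λ w a b c d → w :* a :+ b :+ (w :* c :+ d) := w :* (a :+ c) :+ (b :+ d)) refl _ _ _ _ _)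

      𝕊-X : ∀ m r → (1# - X t) * 𝕊 X m r ≈ X r - X t * X (m ℕ.* t ℕ.+ r)
      𝕊-X zero    r = solve 2 (λ x y → (:1 :- x) :* y := y :- x :* y) refl _ _
      𝕊-X (suc m) r = begin
        (1# - X t) * (X (suc m ℕ.* t ℕ.+ r) + 𝕊 X m r)
          ≈⟨ trans (distribˡ _ _ _) (+-congˡ (𝕊-X m r)) ⟩
        (1# - X t) * X (suc m ℕ.* t ℕ.+ r) + (X r - X t * X (m ℕ.* t ℕ.+ r))
          ≈⟨ +-congˡ (+-congˡ (-‿cong (trans (reflexive (≡.cong X (ℕ.+-assoc t (m ℕ.* t) r))) (X-+ t _)))) ⟨
        (1# - X t) * X (suc m ℕ.* t ℕ.+ r) + (X r - X (suc m ℕ.* t ℕ.+ r))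
          ≈⟨ solve 3 (λ x y r → (:1 :- x) :* y :+ (r :- y) := r :- x :* y) refl _ _ _ ⟩
        X r - X t * X (suc m ℕ.* t ℕ.+ r) ∎

      -- The ratio of this series is `Y t`, but the multiplier is the one used for `X`, so that all
      -- sums share a single denominator. The telescoping therefore runs in the opposite direction.
      𝕊-Y : ∀ m r → (1# - X t) * 𝕊 Y m r ≈ Y (m ℕ.* t ℕ.+ r) - X t * Y r
      𝕊-Y zero    r = solve 2 (λ x y → (:1 :- x) :* y := y :- x :* y) refl _ _
      𝕊-Y (suc m) r = begin
        (1# - X t) * (Y (suc m ℕ.* t ℕ.+ r) + 𝕊 Y m r)
          ≈⟨ trans (distribˡ _ _ _) (+-congˡ (𝕊-Y m r)) ⟩
        (1# - X t) * Y (suc m ℕ.* t ℕ.+ r) + (Y (m ℕ.* t ℕ.+ r) - X t * Y r)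
          ≈⟨ +-congˡ (+-congʳ (trans (*-congˡ (trans (reflexive (≡.cong Y (ℕ.+-assoc t (m ℕ.* t) r))) (Y-+ t _)))
               (trans (sym (*-assoc _ _ _)) (trans (*-congʳ (X*Y t)) (*-identityˡ _))))) ⟨
        (1# - X t) * Y (suc m ℕ.* t ℕ.+ r) + (X t * Y (suc m ℕ.* t ℕ.+ r) - X t * Y r)
          ≈⟨ solve 3 (λ x y r → (:1 :- x) :* y :+ (x :* y :- r) := y :- r) refl _ _ _ ⟩
        Y (suc m ℕ.* t ℕ.+ r) - X t * Y r ∎

      S : ℕ → ℕ → ℕ → ℕ → Carrier
      S M r L s = 𝕊 U M r * 𝕊 U L (suc s) - 𝕊 U M (suc r) * 𝕊 U L s

      exponents : ∀ M r L s → let A = M ℕ.* t ℕ.+ r; B = L ℕ.* t ℕ.+ s in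
        S M r L s ≈ F A B → lsum X (positiveExponents t r s A B) ≈ lsum X (negativeExponents t r s A B)
      exponents M r L s S≈F = trans (lsum-product es) (trans
        (expand (X t) (X r) (X s) (X A) (X B)) (trans (+-congˡ cleared) (trans (contract (X t) (X r) (X s) (X A) (X B)) (sym (lsum-product fs)))))
        where
        A = M ℕ.* t ℕ.+ r
        B = L ℕ.* t ℕ.+ s
        x = X t

        es fs : List (List ℕ)
        es = (r ∷ s ∷ B ∷ B ∷ []) ∷ (r ∷ r ∷ s ∷ A ∷ []) ∷ (t ∷ A ∷ s ∷ s ∷ B ∷ []) ∷
           (t ∷ t ∷ A ∷ A ∷ B ∷ r ∷ []) ∷ (r ∷ s ∷ t ∷ t ∷ B ∷ B ∷ []) ∷ (r ∷ s ∷ t ∷ A ∷ A ∷ []) ∷ []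
        fs = (r ∷ s ∷ s ∷ B ∷ []) ∷ (r ∷ r ∷ t ∷ B ∷ A ∷ []) ∷ (t ∷ t ∷ A ∷ B ∷ B ∷ s ∷ []) ∷
           (r ∷ s ∷ A ∷ A ∷ []) ∷ (r ∷ s ∷ t ∷ t ∷ A ∷ A ∷ []) ∷ (r ∷ s ∷ t ∷ B ∷ B ∷ []) ∷ []

        X-sum : ∀ ns → X (sum ns) ≈ foldr _*_ 1# (map X ns)
        X-sum []       = X₀
        X-sum (n ∷ ns) = trans (X-+ n (sum ns)) (*-congˡ (X-sum ns))

        lsum-product : ∀ nss → lsum X (map sum nss) ≈ lsum (λ ns → foldr _*_ 1# (map X ns)) nss
        lsum-product []         = refl
        lsum-product (ns ∷ nss) = +-cong (X-sum ns) (lsum-product nss)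

        -- Subtracting the members of r, r + t, ..., A from A + r reverses the progression, so the
        -- factor `X A * X r` turns the sum of `Y` into the sum of `X`. Hence both products in
        -- `wedges` acquire the same two factors in `cleared`.
        T₃ : X A * X r * ((1# - x) * 𝕊 Y M r) ≈ X r - x * X A
        T₃ = begin
          X A * X r * ((1# - x) * 𝕊 Y M r)          ≈⟨ *-congˡ (𝕊-Y M r) ⟩
          X A * X r * (Y A - x * Y r)               ≈⟨ solve 5 (λ a a′ r r′ x → a :* r :* (a′ :- x :* r′) := a :* a′ :* r :- x :* a :* (r :* r′)) refl _ _ _ _ _ ⟩
          X A * Y A * X r - x * X A * (X r * Y r)   ≈⟨ +-cong (*-congʳ (X*Y A)) (-‿cong (*-congˡ (X*Y r))) ⟩
          1# * X r - x * X A * 1#                   ≈⟨ +-cong (*-identityˡ _) (-‿cong (*-identityʳ _)) ⟩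
          X r - x * X A                             ∎

        T₄ : X B * X s * ((1# - x) * 𝕊 Y L s) ≈ X s - x * X B
        T₄ = begin
          X B * X s * ((1# - x) * 𝕊 Y L s)          ≈⟨ *-congˡ (𝕊-Y L s) ⟩
          X B * X s * (Y B - x * Y s)               ≈⟨ solve 5 (λ a a′ r r′ x → a :* r :* (a′ :- x :* r′) := a :* a′ :* r :- x :* a :* (r :* r′)) refl _ _ _ _ _ ⟩
          X B * Y B * X s - x * X B * (X s * Y s)   ≈⟨ +-cong (*-congʳ (X*Y B)) (-‿cong (*-congˡ (X*Y s))) ⟩
          1# * X s - x * X B * 1#                   ≈⟨ +-cong (*-identityˡ _) (-‿cong (*-identityʳ _)) ⟩
          X s - x * X B                             ∎

        -- `wedge` is applied to the progression sums and to `U` itself; the factor z - z⁻¹ is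
        -- common, so `S≈F` carries one evaluation into the other.
        wedges : 𝕊 X M r * 𝕊 Y L s - 𝕊 Y M r * 𝕊 X L s ≈ X A * Y B - Y A * X B
        wedges = trans (sym (wedge _ _ _ _ _ _ _ _ (𝕊-suc z U-sucˡ M r) (𝕊-suc z⁻¹ U-sucʳ M r) (𝕊-suc z U-sucˡ L s) (𝕊-suc z⁻¹ U-sucʳ L s)))
          (trans (*-congˡ S≈F) (wedge _ _ _ _ _ _ _ _ (U-sucˡ A) (U-sucʳ A) (U-sucˡ B) (U-sucʳ B)))

        cleared : (X r - x * X A) * (X s - x * X B) * (X A * X r - X B * X s) ≈
                  (1# - x) * (1# - x) * (X r * X s) * (X A * X A - X B * X B)
        cleared = begin
          (X r - x * X A) * (X s - x * X B) * (X A * X r - X B * X s)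
            ≈⟨ solve 4 (λ p q α β → p :* q :* (α :- β) := α :* (p :* q) :- β :* (p :* q)) refl _ _ _ _ ⟩
          X A * X r * ((X r - x * X A) * (X s - x * X B)) - X B * X s * ((X r - x * X A) * (X s - x * X B))
            ≈⟨ +-cong (*-congˡ (*-cong (𝕊-X M r) T₄)) (-‿cong (*-congˡ (*-cong T₃ (𝕊-X L s)))) ⟨
          X A * X r * ((1# - x) * 𝕊 X M r * (X B * X s * ((1# - x) * 𝕊 Y L s))) - X B * X s * (X A * X r * ((1# - x) * 𝕊 Y M r) * ((1# - x) * 𝕊 X L s))
            ≈⟨ solve 7 (λ α β y φ ψ φ′ ψ′ → α :* (y :* φ :* (β :* (y :* ψ′))) :- β :* (α :* (y :* φ′) :* (y :* ψ))
                 := y :* y :* (α :* β) :* (φ :* ψ′ :- φ′ :* ψ)) refl _ _ _ _ _ _ _ ⟩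
          (1# - x) * (1# - x) * (X A * X r * (X B * X s)) * (𝕊 X M r * 𝕊 Y L s - 𝕊 Y M r * 𝕊 X L s)
            ≈⟨ *-congˡ wedges ⟩
          (1# - x) * (1# - x) * (X A * X r * (X B * X s)) * (X A * Y B - Y A * X B)
            ≈⟨ solve 7 (λ y a r b s a′ b′ → y :* y :* (a :* r :* (b :* s)) :* (a :* b′ :- a′ :* b)
                 := y :* y :* (r :* s) :* (a :* a :* (b :* b′) :- b :* b :* (a :* a′))) refl _ _ _ _ _ _ _ ⟩
          (1# - x) * (1# - x) * (X r * X s) * (X A * X A * (X B * Y B) - X B * X B * (X A * Y A))
            ≈⟨ *-congˡ (+-cong (trans (*-congˡ (X*Y B)) (*-identityʳ _)) (-‿cong (trans (*-congˡ (X*Y A)) (*-identityʳ _)))) ⟩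
          (1# - x) * (1# - x) * (X r * X s) * (X A * X A - X B * X B) ∎

        -- The amount that, added to both sides of `cleared`, turns the left side into the positive
        -- and the right side into the negative monomials.
        rest : Carrier → Carrier → Carrier → Carrier → Carrier → Carrier
        rest x r s a b = r * s * b * b + r * s * x * x * b * b + r * s * x * a * a - r * s * x * b * b
          + (r * s * s * b + r * r * x * b * a + r * s * x * a * a + x * x * a * b * b * s)

        expand : ∀ x r s a b →
          r * (s * (b * (b * 1#))) + (r * (r * (s * (a * 1#))) + (x * (a * (s * (s * (b * 1#)))) +
            (x * (x * (a * (a * (b * (r * 1#))))) + (r * (s * (x * (x * (b * (b * 1#))))) + (r * (s * (x * (a * (a * 1#)))) + 0#)))))
          ≈ rest x r s a b + (r - x * a) * (s - x * b) * (a * r - b * s)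
        expand = solve 5 (λ x r s a b →
          r :* (s :* (b :* (b :* :1))) :+ (r :* (r :* (s :* (a :* :1))) :+ (x :* (a :* (s :* (s :* (b :* :1)))) :+
            (x :* (x :* (a :* (a :* (b :* (r :* :1))))) :+ (r :* (s :* (x :* (x :* (b :* (b :* :1))))) :+ (r :* (s :* (x :* (a :* (a :* :1)))) :+ :0)))))
          := r :* s :* b :* b :+ r :* s :* x :* x :* b :* b :+ r :* s :* x :* a :* a :- r :* s :* x :* b :* b
          :+ (r :* s :* s :* b :+ r :* r :* x :* b :* a :+ r :* s :* x :* a :* a :+ x :* x :* a :* b :* b :* s)
           :+ (r :- x :* a) :* (s :- x :* b) :* (a :* r :- b :* s)) refl

        contract : ∀ x r s a b →
          rest x r s a b + (1# - x) * (1# - x) * (r * s) * (a * a - b * b) ≈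
          r * (s * (s * (b * 1#))) + (r * (r * (x * (b * (a * 1#)))) + (x * (x * (a * (b * (b * (s * 1#))))) +
            (r * (s * (a * (a * 1#))) + (r * (s * (x * (x * (a * (a * 1#))))) + (r * (s * (x * (b * (b * 1#)))) + 0#)))))
        contract = solve 5 (λ x r s a b →
          r :* s :* b :* b :+ r :* s :* x :* x :* b :* b :+ r :* s :* x :* a :* a :- r :* s :* x :* b :* b
          :+ (r :* s :* s :* b :+ r :* r :* x :* b :* a :+ r :* s :* x :* a :* a :+ x :* x :* a :* b :* b :* s)
           :+ (:1 :- x) :* (:1 :- x) :* (r :* s) :* (a :* a :- b :* b)
          := r :* (s :* (s :* (b :* :1))) :+ (r :* (r :* (x :* (b :* (a :* :1)))) :+ (x :* (x :* (a :* (b :* (b :* (s :* :1))))) :+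
            (r :* (s :* (a :* (a :* :1))) :+ (r :* (s :* (x :* (x :* (a :* (a :* :1))))) :+ (r :* (s :* (x :* (b :* (b :* :1)))) :+ :0))))) ) refl

      module _ (X-independent : ∀ es fs → lsum X es ≈ lsum X fs → ∀ {k} → k ∈ es → k ∈ fs) where

        classify : ∀ M {r} L {s} → r ℕ.< t → s ℕ.< t → let A = M ℕ.* t ℕ.+ r; B = L ℕ.* t ℕ.+ s in
          B ℕ.< A → S M r L s ≈ F A B → s ≡ B × (A ≡ r ⊎ A ℕ.+ r ≡ t ℕ.+ (B ℕ.+ B))
        classify M {r} L {s} r<t s<t B<A S≈F =
          s≡B , next-exponent {t} {r} {A} {B} r<t (X-independent (drop 1 (positiveExponents t r B A B)) _ second (here ≡.refl))
          where
          A = M ℕ.* t ℕ.+ r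
          B = L ℕ.* t ℕ.+ s
          s≡B : s ≡ B
          s≡B = lowest-exponent r<t s<t B<A (X-independent (positiveExponents t r s A B) _ (exponents M r L s S≈F) (here ≡.refl))
          second : lsum X (drop 1 (positiveExponents t r B A B)) ≈ lsum X (drop 1 (negativeExponents t r B A B))
          second = ∙-cancelˡ (X (sum (r ∷ B ∷ B ∷ B ∷ []))) _ _
            (≡.subst (λ s → lsum X (positiveExponents t r s A B) ≈ lsum X (negativeExponents t r s A B)) s≡B (exponents M r L s S≈F))

      -- The only additional term is `F r r`, which vanishes by antisymmetry.
      S-core : ∀ r → S 1 r 0 r ≈ F (1 ℕ.* t ℕ.+ r) r
      S-core r rewrite ℕ.+-suc (1 ℕ.* t) r =
        solve 4 (λ a b c d → (a :+ b) :* c :- (d :+ c) :* b := a :* c :- d :* b) refl _ _ _ _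

      -- Two additional terms occur, `F (t + r) (r + u)` and `F r (r + u)`. Since `r + u` is the
      -- midpoint of `r` and `t + r`, they are `U u` and `- U u`; this is where the parity of `t`
      -- comes in.
      S-exceptional : ∀ u r → t ≡ u ℕ.+ u → S 2 r 0 (r ℕ.+ u) ≈ F (2 ℕ.* t ℕ.+ r) (r ℕ.+ u)
      S-exceptional u r t≡u+u rewrite ℕ.+-suc (2 ℕ.* t) r | ℕ.+-suc (1 ℕ.* t) r = begin
        (U A + (U C + U r)) * U (suc B) - (U (suc A) + (U (suc C) + U (suc r))) * U B
          ≈⟨ solve 8 (λ a c r a′ c′ r′ b b′ → (a :+ (c :+ r)) :* b′ :- (a′ :+ (c′ :+ r′)) :* b
               := (a :* b′ :- a′ :* b) :+ ((c :* b′ :- c′ :* b) :+ (r :* b′ :- r′ :* b))) refl _ _ _ _ _ _ _ _ ⟩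
        F A B + (F C B + F r B)
          ≈⟨ +-congˡ (+-cong upper lower) ⟩
        F A B + (U u - U u)
          ≈⟨ trans (+-congˡ (-‿inverseʳ _)) (+-identityʳ _) ⟩
        F A B ∎
        where
        A = 2 ℕ.* t ℕ.+ r
        B = r ℕ.+ u
        C = 1 ℕ.* t ℕ.+ r
        C≡ : ∀ u r → 1 ℕ.* (u ℕ.+ u) ℕ.+ r ≡ r ℕ.+ (u ℕ.+ u)
        C≡ = solve-∀
        upper : F C B ≈ U u
        upper = begin
          F C B                            ≡⟨ ≡.cong (λ n → F n B) (≡.trans (≡.cong (λ t → 1 ℕ.* t ℕ.+ r) t≡u+u) (C≡ u r)) ⟩
          F (r ℕ.+ (u ℕ.+ u)) (r ℕ.+ u)    ≈⟨ F-shift r (u ℕ.+ u) u ⟩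
          F (u ℕ.+ u) u                    ≡⟨ ≡.cong (F (u ℕ.+ u)) (ℕ.+-identityʳ u) ⟨
          F (u ℕ.+ u) (u ℕ.+ 0)            ≈⟨ F-shift u u 0 ⟩
          U u * 1# - U (suc u) * 0#        ≈⟨ solve 2 (λ u v → u :* :1 :- v :* :0 := u) refl _ _ ⟩
          U u                              ∎
        lower : F r B ≈ - U u
        lower = begin
          F r B                            ≡⟨ ≡.cong (λ n → F n B) (ℕ.+-identityʳ r) ⟨
          F (r ℕ.+ 0) (r ℕ.+ u)            ≈⟨ F-shift r 0 u ⟩
          0# * U (suc u) - 1# * U u        ≈⟨ solve 2 (λ u v → :0 :* v :- :1 :* u := :- u) refl _ _ ⟩
          - U u                            ∎

-- Beta sets

open import Data.Nat using (_+_; _*_; _∸_; _≤_; _<_; _>_; _≟_; _<?_; ≢-nonZero⁻¹)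
open import Data.Nat.Combinatorics using (_C_; nC1≡n; nCk+nC[k+1]≡[n+1]C[k+1])
open import Data.Nat.Properties
open import Relation.Binary.PropositionalEquality using (refl; sym; trans; cong; cong₂; subst; subst₂; module ≡-Reasoning)

-- Residue classes and cores are defined by filtering decreasing lists; this reduces their
-- evaluation to a question of membership.
decreasing-unique : ∀ {xs ys} → AllPairs _>_ xs → AllPairs _>_ ys →
  (∀ {z} → z ∈ xs → z ∈ ys) → (∀ {z} → z ∈ ys → z ∈ xs) → xs ≡ ys
decreasing-unique []       []       _     _     = refl
decreasing-unique []       (_ ∷ _)  _     ys⊆xs with () ← ys⊆xs (here refl)
decreasing-unique (_ ∷ _)  []       xs⊆ys _     with () ← xs⊆ys (here refl)
decreasing-unique {x ∷ xs} {y ∷ ys} (x>xs ∷ xs>) (y>ys ∷ ys>) xs⊆ys ys⊆xs =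
  cong₂ _∷_ x≡y (decreasing-unique xs> ys>
    (λ z∈ → tail (xs⊆ys (there z∈)) (λ z≡y → <-irrefl (trans z≡y (sym x≡y)) (All.lookup x>xs z∈)))
    (λ z∈ → tail (ys⊆xs (there z∈)) (λ z≡x → <-irrefl (trans z≡x x≡y) (All.lookup y>ys z∈))))
  where
  tail : ∀ {z x xs} → z ∈ x ∷ xs → z ≢ x → z ∈ xs
  tail (here z≡x)  z≢x = contradiction z≡x z≢x
  tail (there z∈)  _   = z∈
  x≡y : x ≡ y
  x≡y with xs⊆ys (here refl) | ys⊆xs (here refl)
  ... | here x≡y | _         = x≡y
  ... | there _  | here y≡x  = sym y≡x
  ... | there x∈ | there y∈  = contradiction (All.lookup y>ys x∈) (<-asym (All.lookup x>xs y∈))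

downFrom-decreasing : ∀ n → AllPairs _>_ (downFrom n)
downFrom-decreasing n = AllPairs.applyDownFrom⁺₁ id n (λ j<i _ → j<i)

all<-downFrom : ∀ {m} n → n ≤ m → All (_< m) (downFrom n)
all<-downFrom n n≤m = All.applyDownFrom⁺₁ id n (λ i<n → <-≤-trans i<n n≤m)

indicator : ∀ {P : Set} → Dec P → ℕ
indicator (yes _) = 1
indicator (no  _) = 0

∷-filter : ∀ {P : ℕ → Set} (P? : ∀ x → Dec (P x)) x xs →
  length (filter P? (x ∷ xs)) ≡ indicator (P? x) + length (filter P? xs)
∷-filter P? x xs with P? x
... | yes _ = refl
... | no  _ = refl

beta-[] : ∀ n → beta n [] ≡ downFrom n
beta-[] zero    = refl
beta-[] (suc n) = cong (n ∷_) (beta-[] n)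

module _ (t : ℕ) .{{_ : NonZero t}} where

  quotRem-% : ∀ {r} q → r < t → (q * t + r) % t ≡ r
  quotRem-% {r} q r<t = trans (cong (_% t) (+-comm (q * t) r)) (trans ([m+kn]%n≡m%n r q t) (m<n⇒m%n≡m r<t))

  quotRem-/ : ∀ {r} q → r < t → (q * t + r) / t ≡ q
  quotRem-/ {r} q r<t = trans (+-distrib-/-∣ˡ {q * t} r (n∣m*n q)) (trans (cong₂ _+_ (m*n/n≡m q t) (m<n⇒m/n≡0 r<t)) (+-identityʳ q))

  class-≡ : ∀ {x i} xs → x % t ≡ i → class t (x ∷ xs) i ≡ x ∷ class t xs i
  class-≡ {i = i} xs eq = List.filter-accept (λ b → b % t ≟ i) {xs = xs} eq

  class-≢ : ∀ {x i} xs → x % t ≢ i → class t (x ∷ xs) i ≡ class t xs i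
  class-≢ {i = i} xs ≢i = List.filter-reject (λ b → b % t ≟ i) {xs = xs} ≢i

  class-downFrom : ∀ {i} → i < t → class t (downFrom t) i ≡ i ∷ []
  class-downFrom {i} i<t = decreasing-unique
    (AllPairs.filter⁺ (λ b → b % t ≟ i) (downFrom-decreasing t)) ([] ∷ [])
    (λ z∈ → let z∈t , z≡i = ∈-filter⁻ (λ b → b % t ≟ i) {xs = downFrom t} z∈ in here (trans (sym (m<n⇒m%n≡m (∈-downFrom⁻ z∈t))) z≡i))
    λ { (here refl) → ∈-filter⁺ (λ b → b % t ≟ i) (∈-downFrom⁺ i<t) (m<n⇒m%n≡m i<t) }

  part-fromBeta-downFrom : ∀ n i → part (fromBeta (downFrom n)) i ≡ 0
  part-fromBeta-downFrom zero    i       = refl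
  part-fromBeta-downFrom (suc n) zero    = trans (cong (n ∸_) (List.length-downFrom n)) (n∸n≡0 n)
  part-fromBeta-downFrom (suc n) (suc i) = part-fromBeta-downFrom n i

  fromBeta-downFrom : ∀ {x y} → fromBeta (x ∷ y ∷ downFrom t) ≋ (x ∸ suc t ∷ y ∸ t ∷ [])
  fromBeta-downFrom {x} zero          = cong (λ n → x ∸ suc n) (List.length-downFrom t)
  fromBeta-downFrom {y = y} (suc zero) = cong (y ∸_) (List.length-downFrom t)
  fromBeta-downFrom (suc (suc i))     = part-fromBeta-downFrom t i

  module _ (λ₁ λ₂ : ℕ) where

    private
      shape : List ℕ
      shape = λ₁ ∷ λ₂ ∷ []

    -- The `t` empty rows fill the positions 0, ..., t - 1, one in each residue class. No class is
    -- ever missed, and only the first two beads carry information.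
    betaSet-twoRows : betaSet t shape ≡ suc λ₁ + t ∷ λ₂ + t ∷ downFrom t
    betaSet-twoRows = trans (cong (λ n → beta n shape) (+-comm t 2))
      (cong₂ (λ x xs → x ∷ λ₂ + t ∷ xs) (+-suc λ₁ t) (beta-[] t))

    private
      a b : ℕ
      a = suc λ₁ % t
      b = λ₂ % t

      beads : ℕ → ℕ
      beads i = length (class t (betaSet t shape) i)

      [_==_] : ℕ → ℕ → ℕ
      [ m == n ] = indicator (m ≟ n)

    beads-twoRows : ∀ {i} → i < t → beads i ≡ [ a == i ] + ([ b == i ] + 1)
    beads-twoRows {i} i<t = begin
      beads i
        ≡⟨ cong (λ β → length (class t β i)) betaSet-twoRows ⟩
      length (class t (suc λ₁ + t ∷ λ₂ + t ∷ downFrom t) i)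
        ≡⟨ ∷-filter (λ b → b % t ≟ i) (suc λ₁ + t) (λ₂ + t ∷ downFrom t) ⟩
      [ (suc λ₁ + t) % t == i ] + length (class t (λ₂ + t ∷ downFrom t) i)
        ≡⟨ cong (_ +_) (∷-filter (λ b → b % t ≟ i) (λ₂ + t) (downFrom t)) ⟩
      [ (suc λ₁ + t) % t == i ] + ([ (λ₂ + t) % t == i ] + length (class t (downFrom t) i))
        ≡⟨ cong₂ (λ x y → [ x == i ] + y) ([m+n]%n≡m%n (suc λ₁) t)
             (cong₂ (λ x y → [ x == i ] + length y) ([m+n]%n≡m%n λ₂ t) (class-downFrom i<t)) ⟩
      [ a == i ] + ([ b == i ] + 1) ∎
      where open ≡-Reasoning

    private
      Occupied : ℕ → Set
      Occupied x = x / t < beads (x % t)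

    occupied : ∀ q {i} → i < t → Occupied (q * t + i) ⇔ q < [ a == i ] + ([ b == i ] + 1)
    occupied q {i} i<t = subst₂ (λ x y → (x < y) ⇔ (q < [ a == i ] + ([ b == i ] + 1)))
      (sym (quotRem-/ q i<t)) (sym (trans (cong beads (quotRem-% q i<t)) (beads-twoRows i<t))) (mk⇔ id id)

    -- Every class has a bead, so the positions below `t` are all occupied after pushing down. If
    -- `c₁` and `c₂` are the only occupied ones above, the parts are their distances to the
    -- positions `t + 1` and `t` of the empty partition.
    core-beads : ∀ {c₁ c₂} → c₂ < c₁ → c₁ < (t + 2) * t → t ≤ c₂ →
      Occupied c₁ → Occupied c₂ →
      (∀ q {i} → i < t → q < [ a == i ] + ([ b == i ] + 1) → q ≢ 0 → q * t + i ≡ c₁ ⊎ q * t + i ≡ c₂) →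
      core t shape ≋ (c₁ ∸ suc t ∷ c₂ ∸ t ∷ [])
    core-beads {c₁} {c₂} c₂<c₁ c₁<max t≤c₂ P₁ P₂ classify =
      subst (λ xs → fromBeta xs ≋ (c₁ ∸ suc t ∷ c₂ ∸ t ∷ [])) (sym beads≡) (fromBeta-downFrom {c₁} {c₂})
      where
      P? : ∀ x → Dec (Occupied x)
      P? x = x / t <? beads (x % t)
      to : ∀ {z} → z ∈ filter P? (downFrom ((t + 2) * t)) → z ∈ c₁ ∷ c₂ ∷ downFrom t
      to {z} z∈ with z / t in eq
      ... | zero  = there (there (∈-downFrom⁺ (m/n≡0⇒m<n eq)))
      ... | suc q with classify (z / t) (m%n<n z t)
                       (Equivalence.to (occupied (z / t) (m%n<n z t)) (subst Occupied z≡ (proj₂ (∈-filter⁻ P? {xs = downFrom ((t + 2) * t)} z∈))))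
                       (λ z/t≡0 → 0≢1+n (trans (sym z/t≡0) eq))
        where
        z≡ : z ≡ z / t * t + z % t
        z≡ = trans (m≡m%n+[m/n]*n z t) (+-comm (z % t) _)
      ...   | inj₁ eq₁ = here (trans (trans (m≡m%n+[m/n]*n z t) (+-comm (z % t) _)) eq₁)
      ...   | inj₂ eq₂ = there (here (trans (trans (m≡m%n+[m/n]*n z t) (+-comm (z % t) _)) eq₂))
      small : ∀ {z} → z < t → Occupied z
      small {z} z<t = Equivalence.from (occupied 0 z<t) (m≤n⇒m≤o+n [ a == z ] (m≤n+m 1 [ b == z ]))
      from : ∀ {z} → z ∈ c₁ ∷ c₂ ∷ downFrom t → z ∈ filter P? (downFrom ((t + 2) * t))
      from (here refl)         = ∈-filter⁺ P? (∈-downFrom⁺ c₁<max) P₁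
      from (there (here refl)) = ∈-filter⁺ P? (∈-downFrom⁺ (<-trans c₂<c₁ c₁<max)) P₂
      from (there (there z∈))  = ∈-filter⁺ P? (∈-downFrom⁺ (<-≤-trans (∈-downFrom⁻ z∈) (≤-trans t≤c₂ (<⇒≤ (<-trans c₂<c₁ c₁<max)))))
                                   (small (∈-downFrom⁻ z∈))
      beads≡ : filter P? (downFrom ((t + 2) * t)) ≡ c₁ ∷ c₂ ∷ downFrom t
      beads≡ = decreasing-unique (AllPairs.filter⁺ P? (downFrom-decreasing ((t + 2) * t)))
        ((c₂<c₁ ∷ All.map (λ z<t → <-≤-trans z<t (≤-trans t≤c₂ (<⇒≤ c₂<c₁))) (all<-downFrom t ≤-refl))
          ∷ (All.map (λ z<t → <-≤-trans z<t t≤c₂) (all<-downFrom t ≤-refl)) ∷ downFrom-decreasing t)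
        to from

    private
      1*t : 1 * t ≡ t
      1*t = *-identityˡ t

      bound : ∀ {q i} → q ≤ 2 → i < t → q * t + i < (t + 2) * t
      bound {q} {i} q≤2 i<t = <-≤-trans (+-monoʳ-< (q * t) i<t) (≤-trans (≤-reflexive (+-comm (q * t) t))
        (*-monoˡ-≤ t (≤-trans (s≤s q≤2) (+-monoˡ-≤ 2 (n≢0⇒n>0 (≢-nonZero⁻¹ t))))))

    core-same : a ≡ b → core t shape ≋ (t + a ∸ 1 ∷ a ∷ [])
    core-same a≡b = subst₂ (λ x y → core t shape ≋ (x ∷ y ∷ [])) eq₁ eq₂
      (core-beads (+-monoˡ-< a (*-monoˡ-< t (n<1+n 1))) (bound {2} ≤-refl a<t) (≤-trans (≤-reflexive (sym 1*t)) (m≤m+n (1 * t) a))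
        (Equivalence.from (occupied 2 a<t) (subst (2 <_) (sym three) ≤-refl))
        (Equivalence.from (occupied 1 a<t) (subst (1 <_) (sym three) (m<n⇒m<1+n (n<1+n 1))))
        classify)
      where
      a<t : a < t
      a<t = m%n<n (suc λ₁) t
      three : [ a == a ] + ([ b == a ] + 1) ≡ 3
      three rewrite sym a≡b with a ≟ a
      ... | yes _   = refl
      ... | no  a≢a = contradiction refl a≢a
      classify : ∀ q {i} → i < t → q < [ a == i ] + ([ b == i ] + 1) → q ≢ 0 → q * t + i ≡ 2 * t + a ⊎ q * t + i ≡ 1 * t + a
      classify q {i} i<t q< q≢0 rewrite sym a≡b with a ≟ i
      classify zero          i<t q< q≢0 | _ = contradiction refl q≢0
      classify (suc zero)    i<t q< q≢0 | yes refl = inj₂ refl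
      classify (suc (suc zero)) i<t q< q≢0 | yes refl = inj₁ refl
      classify (suc (suc (suc q))) i<t (s≤s (s≤s (s≤s ()))) q≢0 | yes refl
      classify (suc q)       i<t (s≤s ()) q≢0 | no _
      eq₁ : 2 * t + a ∸ suc t ≡ t + a ∸ 1
      eq₁ = trans (cong (_∸ suc t) (trans (cong (λ x → t + x + a) (+-identityʳ t)) (+-assoc t t a)))
              (trans (cong (λ x → t + (t + a) ∸ x) (+-comm 1 t)) ([m+n]∸[m+o]≡n∸o t (t + a) 1))
      eq₂ : 1 * t + a ∸ t ≡ a
      eq₂ = trans (cong (λ x → x + a ∸ t) 1*t) (m+n∸m≡n t a)

    core-distinct : ∀ {hi lo} → lo < hi → hi < t → (a ≡ hi × b ≡ lo) ⊎ (a ≡ lo × b ≡ hi) →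
      core t shape ≋ (hi ∸ 1 ∷ lo ∷ [])
    core-distinct {hi} {lo} lo<hi hi<t residues = subst₂ (λ x y → core t shape ≋ (x ∷ y ∷ [])) eq₁ eq₂
      (core-beads (+-monoʳ-< (1 * t) lo<hi) (bound {1} (n≤1+n 1) hi<t) (≤-trans (≤-reflexive (sym 1*t)) (m≤m+n (1 * t) lo))
        (Equivalence.from (occupied 1 hi<t) (positive (Sum.map proj₁ proj₂ residues)))
        (Equivalence.from (occupied 1 (<-trans lo<hi hi<t)) (positive (Sum.swap (Sum.map proj₂ proj₁ residues))))
        classify)
      where
      positive : ∀ {i} → a ≡ i ⊎ b ≡ i → 1 < [ a == i ] + ([ b == i ] + 1)
      positive {i} (inj₁ a≡i) with a ≟ i
      ... | yes _  = s≤s (m≤n+m 1 [ b == i ])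
      ... | no a≢i = contradiction a≡i a≢i
      positive {i} (inj₂ b≡i) with b ≟ i
      ... | yes _  = m≤n+m 2 [ a == i ]
      ... | no b≢i = contradiction b≡i b≢i
      a≢b : a ≢ b
      a≢b a≡b = Sum.[ (λ (a≡hi , b≡lo) → <⇒≢ lo<hi (trans (sym b≡lo) (trans (sym a≡b) a≡hi)))
                    , (λ (a≡lo , b≡hi) → <⇒≢ lo<hi (trans (sym a≡lo) (trans a≡b b≡hi))) ] residues
      hiOrLo : ∀ {i} → a ≡ i ⊎ b ≡ i → i ≡ hi ⊎ i ≡ lo
      hiOrLo (inj₁ refl) = Sum.map proj₁ proj₁ residues
      hiOrLo (inj₂ refl) = Sum.swap (Sum.map proj₂ proj₂ residues)
      unique : ∀ q {i} → q < [ a == i ] + ([ b == i ] + 1) → q ≢ 0 → q ≡ 1 × (a ≡ i ⊎ b ≡ i)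
      unique q {i} q< q≢0 with a ≟ i | b ≟ i
      unique zero       q< q≢0 | _        | _        = contradiction refl q≢0
      unique (suc zero) q< q≢0 | yes a≡i  | _        = refl , inj₁ a≡i
      unique (suc zero) q< q≢0 | no _     | yes b≡i  = refl , inj₂ b≡i
      unique (suc zero) (s≤s ()) q≢0 | no _ | no _
      unique (suc (suc q)) q< q≢0 | yes a≡i | yes b≡i = contradiction (trans a≡i (sym b≡i)) a≢b
      unique (suc (suc q)) (s≤s (s≤s ())) q≢0 | yes _ | no _
      unique (suc (suc q)) (s≤s (s≤s ())) q≢0 | no _ | yes _
      unique (suc (suc q)) (s≤s ()) q≢0 | no _ | no _
      classify : ∀ q {i} → i < t → q < [ a == i ] + ([ b == i ] + 1) → q ≢ 0 → q * t + i ≡ 1 * t + hi ⊎ q * t + i ≡ 1 * t + lo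
      classify q i<t q< q≢0 with refl , i≡ ← unique q q< q≢0 =
        Sum.map (cong (_+_ (1 * t))) (cong (_+_ (1 * t))) (hiOrLo i≡)
      eq₁ : 1 * t + hi ∸ suc t ≡ hi ∸ 1
      eq₁ = trans (cong₂ _∸_ (cong (_+ hi) 1*t) (+-comm 1 t)) ([m+n]∸[m+o]≡n∸o t hi 1)
      eq₂ : 1 * t + lo ∸ t ≡ lo
      eq₂ = trans (cong (λ x → x + lo ∸ t) 1*t) (m+n∸m≡n t lo)

    -- If the two upper beads have different residues, both come to rest in the row just above the
    -- bottom one. If the residues agree, the beads are stacked, one row apart, over the same bottom
    -- bead.
    twoRow-core : λ₂ ≤ λ₁ → shape ≋ core t shape ⇔ (suc λ₁ < t ⊎ (suc λ₁ ≡ t + λ₂ × λ₂ < t))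
    twoRow-core λ₂≤λ₁ = mk⇔ to from
      where
      B<A : λ₂ < suc λ₁
      B<A = s≤s λ₂≤λ₁
      a<t : a < t
      a<t = m%n<n (suc λ₁) t
      b<t : b < t
      b<t = m%n<n λ₂ t
      small : ∀ {hi lo} → lo < hi → hi < t → shape ≋ core t shape → core t shape ≋ (hi ∸ 1 ∷ lo ∷ []) → suc λ₁ < t
      -- `lo < hi` rules out `hi = 0`, where the truncated `hi ∸ 1` would lose information.
      small {suc hi} _ hi<t shape≋core core≋ = subst (_< t) (cong suc (sym (trans (shape≋core 0) (core≋ 0)))) hi<t
      to : shape ≋ core t shape → suc λ₁ < t ⊎ (suc λ₁ ≡ t + λ₂ × λ₂ < t)
      to shape≋core with <-cmp a b
      ... | tri< a<b _ _ = inj₁ (small a<b b<t shape≋core (core-distinct a<b b<t (inj₂ (refl , refl))))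
      ... | tri> _ _ b<a = inj₁ (small b<a a<t shape≋core (core-distinct b<a a<t (inj₁ (refl , refl))))
      ... | tri≈ _ a≡b _ = inj₂ (trans (cong suc λ₁≡) (trans (m+[n∸m]≡n {1} (≤-trans (n≢0⇒n>0 (≢-nonZero⁻¹ t)) (m≤m+n t a))) (cong (_+_ t) (sym λ₂≡a)))
                                , subst (_< t) (sym λ₂≡a) a<t)
        where
        λ₁≡ : λ₁ ≡ t + a ∸ 1
        λ₁≡ = trans (shape≋core 0) (core-same a≡b 0)
        λ₂≡a : λ₂ ≡ a
        λ₂≡a = trans (shape≋core 1) (core-same a≡b 1)
      from : suc λ₁ < t ⊎ (suc λ₁ ≡ t + λ₂ × λ₂ < t) → shape ≋ core t shape
      from (inj₁ A<t) i = sym (core-distinct B<A A<t (inj₁ (m<n⇒m%n≡m A<t , m<n⇒m%n≡m (<-trans B<A A<t))) i)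
      from (inj₂ (A≡t+B , B<t)) i = sym (subst₂ (λ x y → core t shape ≋ (x ∷ y ∷ []))
          (trans (cong (λ x → t + x ∸ 1) a≡B) (cong (_∸ 1) (sym A≡t+B))) a≡B
          (core-same (trans a≡B (sym (m<n⇒m%n≡m B<t)))) i)
        where
        a≡B : a ≡ λ₂
        a≡B = trans (cong (_% t) (trans A≡t+B (+-comm t λ₂))) (trans ([m+n]%n≡m%n λ₂ t) (m<n⇒m%n≡m B<t))

-- Sign, differences, core and quotient in the exceptional family

inversions-downFrom : ∀ n → inversions (downFrom n) ≡ n C 2
inversions-downFrom zero    = refl
inversions-downFrom (suc n) = begin
  length (filter (_<? n) (downFrom n)) + inversions (downFrom n)
    ≡⟨ cong₂ (λ xs k → length xs + k) (List.filter-all (_<? n) (all<-downFrom n ≤-refl)) (inversions-downFrom n) ⟩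
  length (downFrom n) + n C 2  ≡⟨ cong (_+ n C 2) (trans (List.length-downFrom n) (sym (nC1≡n n))) ⟩
  n C 1 + n C 2                ≡⟨ nCk+nC[k+1]≡[n+1]C[k+1] n 1 ⟩
  suc n C 2                    ∎
  where open ≡-Reasoning

sucC2 : ∀ n → suc n C 2 ≡ n + n C 2
sucC2 n = trans (sym (nCk+nC[k+1]≡[n+1]C[k+1] n 1)) (cong (_+ n C 2) (nC1≡n n))

sgn-⊖ : ∀ {m n} → n < m → sgn (m ⊖ n) ≡ 1ℤ
sgn-⊖ {m} {n} n<m rewrite ℤ.⊖-≥ (<⇒≤ n<m) with m ∸ n | m<n⇒0<n∸m n<m
... | suc _ | _ = refl

[-1]^even : ∀ k → -1ℤ ℤ.^ (k + k) ≡ 1ℤ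
[-1]^even k = trans (ℤ.^-distribˡ-+-* -1ℤ k k) (square k)
  where
  square : ∀ k → -1ℤ ℤ.^ k ℤ.* -1ℤ ℤ.^ k ≡ 1ℤ
  square zero    = refl
  square (suc k) = trans (neg-square (-1ℤ ℤ.^ k)) (square k)
    where
    neg-square : ∀ i → (-1ℤ ℤ.* i) ℤ.* (-1ℤ ℤ.* i) ≡ i ℤ.* i
    neg-square i rewrite ℤ.-1*i≡-i i = trans (sym (ℤ.neg-distribˡ-* i (ℤ.- i)))
      (trans (cong ℤ.-_ (sym (ℤ.neg-distribʳ-* i i))) (ℤ.neg-involutive (i ℤ.* i)))

module Exception (t : ℕ) .{{_ : NonZero t}} {u j λ₁ λ₂ : ℕ}
  (t≡u+u : t ≡ u + u) (j<u : j < u) (λ₂≡u+j : λ₂ ≡ u + j) (λ₁≡ : suc λ₁ ≡ t + t + j) where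

  private
    shape : List ℕ
    shape = λ₁ ∷ λ₂ ∷ []
    β : List ℕ
    β = suc λ₁ + t ∷ λ₂ + t ∷ downFrom t

    u≤t : u ≤ t
    u≤t = subst (u ≤_) (sym t≡u+u) (m≤m+n u u)
    j<t : j < t
    j<t = <-≤-trans j<u u≤t
    u+j<t : u + j < t
    u+j<t = subst (u + j <_) (sym t≡u+u) (+-monoʳ-< u j<u)
    j<u+j : j < u + j
    j<u+j = m<n+m j (≤-<-trans z≤n j<u)

    a₁≡ : suc λ₁ + t ≡ 3 * t + j
    a₁≡ = trans (cong (_+ t) λ₁≡) (lemma t j)
      where
      lemma : ∀ t j → t + t + j + t ≡ 3 * t + j
      lemma = solve-∀
    b₁≡ : λ₂ + t ≡ 1 * t + (u + j)
    b₁≡ = trans (cong (_+ t) λ₂≡u+j) (lemma t (u + j))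
      where
      lemma : ∀ t v → v + t ≡ 1 * t + v
      lemma = solve-∀

    a₁%t : (suc λ₁ + t) % t ≡ j
    a₁%t = trans (cong (_% t) a₁≡) (quotRem-% t 3 j<t)
    b₁%t : (λ₂ + t) % t ≡ u + j
    b₁%t = trans (cong (_% t) b₁≡) (quotRem-% t 1 u+j<t)

    class-β : ∀ i → class t (betaSet t shape) i ≡ class t β i
    class-β i = cong (λ xs → class t xs i) (betaSet-twoRows t λ₁ λ₂)

    class-j : class t (betaSet t shape) j ≡ suc λ₁ + t ∷ j ∷ []
    class-j = trans (class-β j) (trans (class-≡ t _ a₁%t) (cong (suc λ₁ + t ∷_)
      (trans (class-≢ t _ (λ eq → <⇒≢ j<u+j (trans (sym eq) b₁%t))) (class-downFrom t j<t))))

    class-u+j : class t (betaSet t shape) (u + j) ≡ λ₂ + t ∷ u + j ∷ []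
    class-u+j = trans (class-β (u + j)) (trans (class-≢ t _ (λ eq → <⇒≢ j<u+j (trans (sym a₁%t) eq)))
      (trans (class-≡ t _ b₁%t) (cong (λ₂ + t ∷_) (class-downFrom t u+j<t))))

    class-other : ∀ i → i < t → i ≢ j → i ≢ u + j → class t (betaSet t shape) i ≡ i ∷ []
    class-other i i<t i≢j i≢u+j = trans (class-β i) (trans (class-≢ t _ (λ eq → i≢j (trans (sym eq) a₁%t)))
      (trans (class-≢ t _ (λ eq → i≢u+j (trans (sym eq) b₁%t))) (class-downFrom t i<t)))

  P : Pairs
  P = pairs (suc λ₁ + t) j (λ₂ + t) (u + j)

  isPairs : IsPairs t shape P
  isPairs = twoDouble j<u+j u+j<t class-j class-u+j
    (λ i i<t i≢j i≢u+j → cong length (class-other i i<t i≢j i≢u+j))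

  private
    -- The sums are 3t + 2j and t + 2u + 2j, and 2u = t; so their difference is t, with positive
    -- sign.
    sum≡ : suc λ₁ + t + j ≡ t + (λ₂ + t + (u + j))
    sum≡ = begin
      suc λ₁ + t + j                        ≡⟨ cong (λ n → n + t + j) λ₁≡ ⟩
      t + t + j + t + j                     ≡⟨ cong (λ n → t + n + j + t + j) t≡u+u ⟩
      t + (u + u) + j + t + j               ≡⟨ lemma t u j ⟩
      t + ((u + j) + t + (u + j))           ≡⟨ cong (λ n → t + (n + t + (u + j))) λ₂≡u+j ⟨
      t + (λ₂ + t + (u + j))                ∎
      where
      open ≡-Reasoning
      lemma : ∀ t u j → t + (u + u) + j + t + j ≡ t + ((u + j) + t + (u + j))
      lemma = solve-∀

    b-sum<a-sum : λ₂ + t + (u + j) < suc λ₁ + t + j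
    b-sum<a-sum = subst (λ₂ + t + (u + j) <_) (sym sum≡) (m<n+m _ (≤-<-trans z≤n j<t))

    b₁<a₁ : λ₂ + t < suc λ₁ + t
    b₁<a₁ = +-monoˡ-< t (subst₂ _<_ (sym λ₂≡u+j) (sym λ₁≡) (<-≤-trans u+j<t (≤-trans (m≤m+n t t) (m≤m+n (t + t) j))))

  differences : (Pairs.d₁ P ∷ Pairs.d₂ P ∷ Pairs.d₃ P ∷ []) ↭ (3 * t ∷ t ∷ t ∷ [])
  differences = ↭-reflexive (cong₂ _∷_ d₁≡ (cong₂ (λ x y → x ∷ y ∷ []) d₂≡ d₃≡))
    where
    d₁≡ : Pairs.d₁ P ≡ 3 * t
    d₁≡ = trans (cong (_∸ j) a₁≡) (m+n∸n≡m (3 * t) j)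
    d₂≡ : Pairs.d₂ P ≡ t
    d₂≡ = trans (cong (_∸ (u + j)) b₁≡) (trans (m+n∸n≡m (1 * t) (u + j)) (*-identityˡ t))
    d₃≡ : Pairs.d₃ P ≡ t
    d₃≡ = trans (cong ℤ.∣_∣ (ℤ.⊖-≥ (<⇒≤ b-sum<a-sum)))
      (trans (cong (_∸ (λ₂ + t + (u + j))) sum≡) (m+n∸n≡m t (λ₂ + t + (u + j))))

  private
    column-first : ∀ x xs → column x (x ∷ xs) ≡ 1
    column-first x xs with x ≟ x
    ... | yes _   = refl
    ... | no  x≢x = contradiction refl x≢x

    column-second : ∀ x y xs → x ≢ y → column x (y ∷ x ∷ xs) ≡ 2
    column-second x y xs x≢y with x ≟ y
    ... | yes x≡y = contradiction x≡y x≢y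
    ... | no  _   = cong suc (column-first x xs)

    other? : ∀ b → Dec (b ≢ suc λ₁ + t × b ≢ λ₂ + t)
    other? b = ¬? (b ≟ suc λ₁ + t) ×-dec ¬? (b ≟ λ₂ + t)

    others : filter other? β ≡ downFrom t
    others = trans (List.filter-reject other? {xs = λ₂ + t ∷ downFrom t} (λ (≢a₁ , _) → ≢a₁ refl))
      (trans (List.filter-reject other? {xs = downFrom t} (λ (_ , ≢b₁) → ≢b₁ refl))
        (List.filter-all other? (All.map (λ z<t → (λ z≡ → <⇒≢ (<-≤-trans z<t (m≤n+m t (suc λ₁))) z≡)
                                           , (λ z≡ → <⇒≢ (<-≤-trans z<t (m≤n+m t λ₂)) z≡)) (all<-downFrom t ≤-refl))))

    residues-downFrom : ∀ n → n ≤ t → map (_% t) (downFrom n) ≡ downFrom n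
    residues-downFrom zero    _   = refl
    residues-downFrom (suc n) n<t = cong₂ _∷_ (m<n⇒m%n≡m n<t) (residues-downFrom n (<⇒≤ n<t))

    even : ∀ t c → t + (2 + t + (1 + t + (t + c))) + (3 + c) ≡ (t + t + 3 + c) + (t + t + 3 + c)
    even = solve-∀

  -- The beads a₁ and b₁ occupy columns 1 and 2, and the word t - 1, ..., 0 that remains has t C 2
  -- inversions. As (t + 3) C 2 = t C 2 + 3t + 3, the total exponent of -1 is 2(2t + 3 + t C 2), and
  -- both `sgn` factors are 1.
  ε≡1 : ε t shape P ≡ 1ℤ
  ε≡1 rewrite betaSet-twoRows t λ₁ λ₂ | column-first (suc λ₁ + t) (λ₂ + t ∷ downFrom t)
            | column-second (λ₂ + t) (suc λ₁ + t) (downFrom t) (<⇒≢ b₁<a₁)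
            | others | residues-downFrom t ≤-refl | inversions-downFrom t
            | sgn-⊖ b₁<a₁ | sgn-⊖ b-sum<a-sum = begin
    -1ℤ ℤ.^ (t + (t + 2 + 1) C 2) ℤ.* -1ℤ ℤ.^ (3 + t C 2) ℤ.* 1ℤ ℤ.* 1ℤ
      ≡⟨ trans (ℤ.*-identityʳ _) (ℤ.*-identityʳ _) ⟩
    -1ℤ ℤ.^ (t + (t + 2 + 1) C 2) ℤ.* -1ℤ ℤ.^ (3 + t C 2)
      ≡⟨ ℤ.^-distribˡ-+-* -1ℤ (t + (t + 2 + 1) C 2) (3 + t C 2) ⟨
    -1ℤ ℤ.^ (t + (t + 2 + 1) C 2 + (3 + t C 2))
      ≡⟨ cong (-1ℤ ℤ.^_) (trans (cong (λ c → t + c + (3 + t C 2)) binomial) (even t (t C 2))) ⟩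
    -1ℤ ℤ.^ ((t + t + 3 + t C 2) + (t + t + 3 + t C 2))
      ≡⟨ [-1]^even (t + t + 3 + t C 2) ⟩
    1ℤ ∎
    where
    open ≡-Reasoning
    binomial : (t + 2 + 1) C 2 ≡ 2 + t + (1 + t + (t + t C 2))
    binomial = trans (cong (_C 2) (trans (+-comm (t + 2) 1) (cong suc (+-comm t 2))))
      (trans (sucC2 (2 + t)) (cong (2 + t +_) (trans (sucC2 (1 + t)) (cong (1 + t +_) (sucC2 t)))))

  core≋ : core t shape ≋ (u ∸ 1 + j ∷ j ∷ [])
  core≋ = subst (λ x → core t shape ≋ (x ∷ j ∷ [])) (+-∸-comm j (≤-<-trans z≤n j<u))
    (core-distinct t λ₁ λ₂ j<u+j u+j<t (inj₂ (trans (sym ([m+n]%n≡m%n (suc λ₁) t)) a₁%t , trans (sym ([m+n]%n≡m%n λ₂ t)) b₁%t)))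

  -- The beads of class `j` lie at heights 3 and 0, which gives the parts 3 - 1 and 0. In class
  -- `u + j` the heights are 1 and 0, and in every other class there is one bead at height 0.
  quotient-j : quotient t shape j ≋ (2 ∷ [])
  quotient-j = subst (λ xs → fromBeta xs ≋ (2 ∷ []))
    (sym (trans (cong (map (_/ t)) class-j)
      (cong₂ (λ x y → x ∷ y ∷ []) (trans (cong (_/ t) a₁≡) (quotRem-/ t 3 j<t)) (m<n⇒m/n≡0 j<t))))
    λ { zero → refl ; (suc zero) → refl ; (suc (suc i)) → refl }

  quotient-other : ∀ i → i < t → i ≢ j → quotient t shape i ≋ []
  quotient-other i i<t i≢j with i ≟ u + j
  ... | yes refl = subst (λ xs → fromBeta xs ≋ [])
    (sym (trans (cong (map (_/ t)) class-u+j)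
      (cong₂ (λ x y → x ∷ y ∷ []) (trans (cong (_/ t) b₁≡) (quotRem-/ t 1 u+j<t)) (m<n⇒m/n≡0 u+j<t))))
    λ { zero → refl ; (suc zero) → refl ; (suc (suc i)) → refl }
  ... | no i≢u+j = subst (λ xs → fromBeta xs ≋ [])
    (sym (trans (cong (map (_/ t)) (class-other i i<t i≢j i≢u+j)) (cong (_∷ []) (m<n⇒m/n≡0 i<t))))
    λ { zero → refl ; (suc i) → refl }

-- Arithmetic of the exceptional family

-- A form of `Exceptional` free of division and truncated subtraction, with u = t/2 and j the slot
-- of the quotient. From λ₁ + 1 = λ₂ + 3u = 4u + j one sees that λ₁ + 1 has quotient 2 and residue j
-- modulo t.
ExceptionalData : (t λ₁ λ₂ : ℕ) → Set
ExceptionalData t λ₁ λ₂ = Σ[ u ∈ ℕ ] Σ[ j ∈ ℕ ] (t ≡ u + u × j < u × λ₂ ≡ u + j × suc λ₁ ≡ t + t + j)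

u+u/2 : ∀ {t} u → t ≡ u + u → t / 2 ≡ u
u+u/2 {t} u t≡u+u = trans (cong (_/ 2) (trans t≡u+u (double u))) (m*n/n≡m u 2)
  where
  double : ∀ u → u + u ≡ u * 2
  double = solve-∀

3*[u+u]/2 : ∀ {t} u → t ≡ u + u → (3 * t) / 2 ≡ 3 * u
3*[u+u]/2 {t} u t≡u+u = trans (cong (λ n → (3 * n) / 2) t≡u+u) (trans (cong (_/ 2) (double u)) (m*n/n≡m (3 * u) 2))
  where
  double : ∀ u → 3 * (u + u) ≡ 3 * u * 2
  double = solve-∀

exceptional⇒ : ∀ {t λ₁ λ₂} .{{_ : NonZero t}} → Exceptional t λ₁ λ₂ → ExceptionalData t λ₁ λ₂
exceptional⇒ {t} {λ₁} {λ₂} (divides u t≡u*2 , λ₁≡ , half≤λ₂ , λ₂≤t-1) =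
  u , λ₂ ∸ u , t≡u+u , j<u , sym u+j≡λ₂ , suc-λ₁
  where
  double : ∀ u → u * 2 ≡ u + u
  double = solve-∀
  t≡u+u : t ≡ u + u
  t≡u+u = trans t≡u*2 (double u)
  0<t : 0 < t
  0<t = n≢0⇒n>0 (ℕ.≢-nonZero⁻¹ t)
  0<u : 0 < u
  0<u = n≢0⇒n>0 λ { refl → <⇒≢ 0<t (sym t≡u+u) }
  u+j≡λ₂ : u + (λ₂ ∸ u) ≡ λ₂
  u+j≡λ₂ = m+[n∸m]≡n (subst (_≤ λ₂) (u+u/2 u t≡u+u) half≤λ₂)
  j<u : λ₂ ∸ u < u
  j<u = +-cancelˡ-< u (λ₂ ∸ u) u (subst₂ _<_ (sym u+j≡λ₂) t≡u+u
    (subst (λ₂ <_) (m+[n∸m]≡n 0<t) (s≤s λ₂≤t-1)))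
  regroup : ∀ u j → u + j + 3 * u ≡ u + u + (u + u) + j
  regroup = solve-∀
  suc-λ₁ : suc λ₁ ≡ t + t + (λ₂ ∸ u)
  suc-λ₁ = begin
    suc λ₁                           ≡⟨ cong suc λ₁≡ ⟩
    1 + (λ₂ + (3 * t) / 2 ∸ 1)       ≡⟨ cong (λ n → 1 + (λ₂ + n ∸ 1)) (3*[u+u]/2 u t≡u+u) ⟩
    1 + (λ₂ + 3 * u ∸ 1)             ≡⟨ m+[n∸m]≡n (≤-trans 0<u (≤-trans (m≤n*m u 3) (m≤n+m (3 * u) λ₂))) ⟩
    λ₂ + 3 * u                       ≡⟨ cong (_+ 3 * u) u+j≡λ₂ ⟨
    u + (λ₂ ∸ u) + 3 * u             ≡⟨ regroup u (λ₂ ∸ u) ⟩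
    u + u + (u + u) + (λ₂ ∸ u)       ≡⟨ cong (λ n → n + n + (λ₂ ∸ u)) t≡u+u ⟨
    t + t + (λ₂ ∸ u)                 ∎
    where open ≡.≡-Reasoning

exceptional⇐ : ∀ {t λ₁ λ₂} → ExceptionalData t λ₁ λ₂ → Exceptional t λ₁ λ₂
exceptional⇐ {t} {λ₁} {λ₂} (u , j , t≡u+u , j<u , λ₂≡u+j , suc-λ₁) =
    divides u (trans t≡u+u (double u))
  , cong (_∸ 1) (trans suc-λ₁ (trans (cong (λ n → n + n + j) t≡u+u) (trans (regroup u j)
      (cong₂ _+_ (sym λ₂≡u+j) (sym (3*[u+u]/2 u t≡u+u))))))
  , subst₂ _≤_ (sym (u+u/2 u t≡u+u)) (sym λ₂≡u+j) (m≤m+n u j)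
  , subst₂ (λ m n → m ≤ n ∸ 1) (sym λ₂≡u+j) (sym t≡u+u) (∸-monoˡ-≤ 1 (+-monoʳ-< u j<u))
  where
  double : ∀ u → u + u ≡ u * 2
  double = solve-∀
  regroup : ∀ u j → u + u + (u + u) + j ≡ u + j + 3 * u
  regroup = solve-∀

-- The second alternative reads Mt + 2r = t + 2λ₂, and λ₂ < t bounds M by 2. For M = 1 it says r =
-- λ₂, a core; for M = 2 it says t = 2(λ₂ - r), which supplies u = λ₂ - r and j = r.
solutions : ∀ t M {r λ₁ λ₂} → suc λ₁ ≡ M * t + r → r < t → λ₂ < t →
  M * t + r ≡ r ⊎ M * t + r + r ≡ t + (λ₂ + λ₂) →
  (suc λ₁ < t ⊎ (suc λ₁ ≡ t + λ₂ × λ₂ < t)) ⊎ ExceptionalData t λ₁ λ₂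
solutions t M A≡ r<t B<t (inj₁ Mt+r≡r) = inj₁ (inj₁ (subst (_< t) (sym (trans A≡ Mt+r≡r)) r<t))
solutions t zero A≡ r<t B<t (inj₂ eq) = inj₁ (inj₁ (subst (_< t) (sym A≡) r<t))
solutions t 1 {r} {λ₁} {λ₂} A≡ r<t B<t (inj₂ eq) =
  inj₁ (inj₂ (trans A≡ (trans (cong (_+ r) (*-identityˡ t)) (cong (t +_) r≡B)) , B<t))
  where
  regroup : ∀ t r → t + (r + r) ≡ 1 * t + r + r
  regroup = solve-∀
  double : ∀ n → n + n ≡ n * 2
  double = solve-∀
  r≡B : r ≡ λ₂
  r≡B = *-cancelʳ-≡ r λ₂ 2 (trans (sym (double r)) (trans (+-cancelˡ-≡ t (r + r) (λ₂ + λ₂) (trans (regroup t r) eq)) (double λ₂)))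
solutions t 2 {r} {λ₁} {λ₂} A≡ r<t B<t (inj₂ eq) =
  inj₂ (u , r , t≡u+u , r<u , sym u+r≡B , trans A≡ (2* t r))
  where
  2* : ∀ t r → 2 * t + r ≡ t + t + r
  2* = solve-∀
  regroup : ∀ t r → t + (t + (r + r)) ≡ 2 * t + r + r
  regroup = solve-∀
  t+2r≡2B : t + (r + r) ≡ λ₂ + λ₂
  t+2r≡2B = +-cancelˡ-≡ t _ _ (trans (regroup t r) eq)
  r≤B : r ≤ λ₂
  r≤B = ≮⇒≥ λ B<r → <⇒≢ (<-≤-trans (+-mono-< B<r B<r) (m≤n+m (r + r) t)) (sym t+2r≡2B)
  u : ℕ
  u = λ₂ ∸ r
  u+r≡B : u + r ≡ λ₂
  u+r≡B = m∸n+n≡m r≤B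
  swap : ∀ u r → u + r + (u + r) ≡ u + u + (r + r)
  swap = solve-∀
  t≡u+u : t ≡ u + u
  t≡u+u = +-cancelʳ-≡ (r + r) t (u + u) (trans t+2r≡2B (trans (cong₂ _+_ (sym u+r≡B) (sym u+r≡B)) (swap u r)))
  r<u : r < u
  r<u = +-cancelˡ-< u r u (subst₂ _<_ (sym u+r≡B) t≡u+u B<t)
solutions t (suc (suc (suc M))) {r} {λ₁} {λ₂} A≡ r<t B<t (inj₂ eq) =
  contradiction (trans (regroup t M r) eq)
    (λ eq → <⇒≢ (+-monoʳ-< t (<-≤-trans (+-mono-< B<t B<t) (m≤m+n (t + t) (M * t + r + r)))) (sym eq))
  where
  regroup : ∀ t M r → t + (t + t + (M * t + r + r)) ≡ (3 + M) * t + r + r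
  regroup = solve-∀

-- The criterion over a commutative ring with abstract monomials

module Criterion {c ℓ} (R : CommutativeRing c ℓ) where
  open CommutativeRing R using (Carrier; _≈_; 0#; 1#)
    renaming (_*_ to _⊗_; refl to ≈-refl; sym to ≈-sym; trans to ≈-trans;
              +-cong to ⊕-cong; *-cong to ⊗-cong; -‿cong to ⊖-cong)
  open JacobiTrudi R using (lsum)
  open CompleteHomogeneous R
  open Wedge R

  module TwoRows
    (f : ℕ → Carrier) (f-zero : f 0 ≈ 1#) (f-+ : ∀ m n → f (m + n) ≈ f m ⊗ f n)
    (X Y : ℕ → Carrier) (X₀ : X 0 ≈ 1#) (Y₀ : Y 0 ≈ 1#)
    (X-+ : ∀ m n → X (m + n) ≈ X m ⊗ X n) (Y-+ : ∀ m n → Y (m + n) ≈ Y m ⊗ Y n)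
    (X*Y : ∀ n → X n ⊗ Y n ≈ 1#)
    (X-independent : ∀ es fs → lsum X es ≈ lsum X fs → ∀ {k} → k ∈ es → k ∈ fs)
    (t : ℕ) .{{_ : NonZero t}} (f-t : f t ≈ 1#)
    (f-cancel : ∀ {k} → 0 < k → k < t → ∀ {y} → f k ⊗ y ≈ y → y ≈ 0#)
    {λ₁ λ₂ : ℕ} (λ₂≤λ₁ : λ₂ ≤ λ₁)
    where

    open RootsOfUnity f f-zero f-+ t f-t f-cancel
    open Monomials X Y X₀ Y₀ X-+ Y-+ X*Y
    open Progressions t

    private
      𝕤 : ∀ {n} → Vec Carrier n → Carrier
      𝕤 xs = schur (Semiring.rawSemiring (CommutativeRing.semiring R)) xs (λ₁ ∷ λ₂ ∷ [])

      Identity : Set ℓ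
      Identity = 𝕤 (Vec.tabulate {n = t} (λ i → f (toℕ i)) Vec.++ X 1 ∷ Y 1 ∷ []) ≈ 𝕤 (X 1 ∷ Y 1 ∷ [])

    schur-roots : ∀ M {r} L {s} → r < t → s < t → suc λ₁ ≡ M * t + r → λ₂ ≡ L * t + s →
      𝕤 (geometric 0 t Vec.++ X 1 ∷ Y 1 ∷ []) ≈ S M r L s
    schur-roots M {r} L {s} r<t s<t A≡ B≡ = ≈-trans
      (schur-twoRows {{ℕ.>-nonZero (≤-trans (s≤s z≤n) (m≤n+m 2 t))}} xs λ₂≤λ₁)
      (⊕-cong (⊗-cong (at M (<⇒≤ r<t) A≡) (at L s<t (trans (cong suc B≡) (sym (+-suc (L * t) s)))))
        (⊖-cong (⊗-cong (at M r<t (trans (cong suc A≡) (sym (+-suc (M * t) r)))) (at L (<⇒≤ s<t) B≡))))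
      where
      xs = geometric 0 t Vec.++ X 1 ∷ Y 1 ∷ []
      at : ∀ {n} m {r} → r ≤ t → n ≡ m * t + r → h₋₁ xs n ≈ progressionSum t U m r
      at m r≤t refl = h₋₁-roots (X 1 ∷ Y 1 ∷ []) m r≤t

    identity⇔ : ∀ M {r} L {s} → r < t → s < t → suc λ₁ ≡ M * t + r → λ₂ ≡ L * t + s →
      Identity ⇔ S M r L s ≈ F (suc λ₁) λ₂
    identity⇔ M {r} L {s} r<t s<t A≡ B≡ = mk⇔
      (λ identity → ≈-trans (≈-sym roots) (≈-trans identity (schur-twoRows (X 1 ∷ Y 1 ∷ []) λ₂≤λ₁)))
      (λ S≈F → ≈-trans roots (≈-trans S≈F (≈-sym (schur-twoRows (X 1 ∷ Y 1 ∷ []) λ₂≤λ₁))))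
      where
      roots : 𝕤 (Vec.tabulate {n = t} (λ i → f (toℕ i)) Vec.++ X 1 ∷ Y 1 ∷ []) ≈ S M r L s
      roots = subst (λ v → 𝕤 (v Vec.++ X 1 ∷ Y 1 ∷ []) ≈ S M r L s)
        (sym (geometric-tabulate 0 t)) (schur-roots M L r<t s<t A≡ B≡)

    identity⇒ : Identity → (suc λ₁ < t ⊎ (suc λ₁ ≡ t + λ₂ × λ₂ < t)) ⊎ ExceptionalData t λ₁ λ₂
    identity⇒ identity = solutions t M A≡ r<t (subst (_< t) (trans (proj₁ result) (sym B≡)) s<t)
      (subst (λ n → M * t + r ≡ r ⊎ M * t + r + r ≡ t + (n + n)) (sym B≡) (proj₂ result))
      where
      M = suc λ₁ / t
      r = suc λ₁ % t
      L = λ₂ / t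
      s = λ₂ % t
      r<t : r < t
      r<t = m%n<n (suc λ₁) t
      s<t : s < t
      s<t = m%n<n λ₂ t
      A≡ : suc λ₁ ≡ M * t + r
      A≡ = trans (m≡m%n+[m/n]*n (suc λ₁) t) (+-comm r (M * t))
      B≡ : λ₂ ≡ L * t + s
      B≡ = trans (m≡m%n+[m/n]*n λ₂ t) (+-comm s (L * t))
      result : s ≡ L * t + s × (M * t + r ≡ r ⊎ M * t + r + r ≡ t + (L * t + s + (L * t + s)))
      result = classify X-independent M L r<t s<t (subst₂ _<_ B≡ A≡ (s≤s λ₂≤λ₁))
        (subst₂ (λ m n → S M r L s ≈ F m n) A≡ B≡ (Equivalence.to (identity⇔ M L r<t s<t A≡ B≡) identity))

    identity⇐ : (suc λ₁ < t ⊎ (suc λ₁ ≡ t + λ₂ × λ₂ < t)) ⊎ ExceptionalData t λ₁ λ₂ → Identity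
    -- With both quotients zero, the double sum consists of the term `F (suc λ₁) λ₂` alone.
    identity⇐ (inj₁ (inj₁ A<t)) =
      Equivalence.from (identity⇔ 0 0 A<t (<-trans (s≤s λ₂≤λ₁) A<t) refl refl) ≈-refl
    identity⇐ (inj₁ (inj₂ (A≡t+B , B<t))) =
      Equivalence.from (identity⇔ 1 0 B<t B<t A≡ refl) (subst (λ n → S 1 λ₂ 0 λ₂ ≈ F n λ₂) (sym A≡) (S-core λ₂))
      where
      A≡ : suc λ₁ ≡ 1 * t + λ₂
      A≡ = trans A≡t+B (cong (_+ λ₂) (sym (*-identityˡ t)))
    identity⇐ (inj₂ (u , j , t≡u+u , j<u , λ₂≡u+j , suc-λ₁)) =
      Equivalence.from (identity⇔ 2 0 (<-≤-trans j<u (subst (u ≤_) (sym t≡u+u) (m≤m+n u u)))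
          (subst (j + u <_) (sym t≡u+u) (+-monoˡ-< u j<u)) A≡ B≡)
        (subst₂ (λ m n → S 2 j 0 (j + u) ≈ F m n) (sym A≡) (sym B≡) (S-exceptional u j t≡u+u))
      where
      A≡ : suc λ₁ ≡ 2 * t + j
      A≡ = trans suc-λ₁ (cong (λ n → t + n + j) (sym (+-identityʳ t)))
      B≡ : λ₂ ≡ j + u
      B≡ = trans λ₂≡u+j (+-comm u j)

-- Laurent polynomials over a Heyting field of characteristic zero

module _ {c ℓ₁ ℓ₂} (K : HeytingField c ℓ₁ ℓ₂) where

  private
    R : CommutativeRing c ℓ₁
    R = HeytingCommutativeRing.commutativeRing (HeytingField.heytingCommutativeRing K)
    module K = CommutativeRing R
  open LaurentRing R
  open Laurent (fieldRaw K) using (const)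
  open import Algebra.Properties.Semiring.Exp K.semiring using (_^_; ^-homo-*)
  open import Algebra.Properties.Ring K.ring using (-0#≈0#)

  -- Whether `y` is zero cannot be decided, but by tightness it suffices to refute `y # 0`. An
  -- element apart from zero is invertible, and cancelling it would give `x ≈ 1`.
  fixed⇒0 : ∀ {x y} → ¬ (x K.≈ K.1#) → x K.* y K.≈ y → y K.≈ K.0#
  fixed⇒0 {x} {y} x≉1 xy≈y = proj₁ (HeytingField.tight K y K.0#) λ y#0 →
    let y⁻¹ , _ , y*y⁻¹≈1 = HeytingField.#⇒invertible K y#0
        yy⁻¹≈1 : y K.* y⁻¹ K.≈ K.1#
        yy⁻¹≈1 = K.trans (K.*-congʳ (K.sym (K.trans (K.+-congˡ -0#≈0#) (K.+-identityʳ y)))) y*y⁻¹≈1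
    in x≉1 (K.trans (K.sym (K.*-identityʳ x)) (K.trans (K.*-congˡ (K.sym yy⁻¹≈1))
      (K.trans (K.sym (K.*-assoc x y y⁻¹)) (K.trans (K.*-congʳ xy≈y) yy⁻¹≈1))))

  schurIdentity⇔ : ∀ t .{{_ : NonZero t}} ζ → CharacteristicZero K → PrimitiveRoot K t ζ →
    ∀ {λ₁ λ₂} → λ₂ ≤ λ₁ →
    SchurIdentity K t ζ (λ₁ ∷ λ₂ ∷ []) ⇔
      ((suc λ₁ < t ⊎ (suc λ₁ ≡ t + λ₂ × λ₂ < t)) ⊎ ExceptionalData t λ₁ λ₂)
  schurIdentity⇔ t ζ char0 (ζ^t≈1 , ζ^k≉1) λ₂≤λ₁ = mk⇔ identity⇒ identity⇐
    where
    open Criterion.TwoRows laurentRing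
      (λ k → const (ζ ^ k)) (λ _ → K.refl) (λ m n → term-cong {e = 0ℤ} (^-homo-* ζ m n) refl)
      X Y (λ _ → K.refl) (λ _ → K.refl) X-+ Y-+ X∙Y (λ es fs → ∑X-∈ char0 {es} {fs})
      t (term-cong {e = 0ℤ} ζ^t≈1 refl)
      -- A constant multiplies each coefficient separately, so cancellation among Laurent
      -- polynomials reduces to the field.
      (λ {k} 0<k k<t {y} fixed i → fixed⇒0 (ζ^k≉1 k 0<k k<t)
        (K.trans (K.sym (coeff-const-∙ (ζ ^ k) y i)) (fixed i)))
      λ₂≤λ₁

theorem5p2 : ∀ {c ℓ₁ ℓ₂ : Level} (t : ℕ) .{{_ : NonZero t}} → 2 ≤ t →
    (λ₁ λ₂ : ℕ) → λ₂ ≤ λ₁ →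
    ((K : HeytingField c ℓ₁ ℓ₂) (ζ : HeytingField.Carrier K) →
    CharacteristicZero K → PrimitiveRoot K t ζ →
    SchurIdentity K t ζ (λ₁ ∷ λ₂ ∷ [])
    ⇔ ((λ₁ ∷ λ₂ ∷ []) ≋ core t (λ₁ ∷ λ₂ ∷ []) ⊎ Exceptional t λ₁ λ₂))
    × (Exceptional t λ₁ λ₂ →
    (Σ[ P ∈ Pairs ] IsPairs t (λ₁ ∷ λ₂ ∷ []) P
    × (Pairs.d₁ P ∷ Pairs.d₂ P ∷ Pairs.d₃ P ∷ []) ↭ (3 * t ∷ t ∷ t ∷ [])
    × ε t (λ₁ ∷ λ₂ ∷ []) P ≡ 1ℤ)
    × core t (λ₁ ∷ λ₂ ∷ []) ≋ (t / 2 ∸ 1 + (λ₂ ∸ t / 2) ∷ λ₂ ∸ t / 2 ∷ [])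
    × quotient t (λ₁ ∷ λ₂ ∷ []) (λ₂ ∸ t / 2) ≋ (2 ∷ [])
    × (∀ i → i < t → i ≢ λ₂ ∸ t / 2 → quotient t (λ₁ ∷ λ₂ ∷ []) i ≋ []))
theorem5p2 t 2≤t λ₁ λ₂ λ₂≤λ₁ =
    (λ K ζ char0 ζ-primitive → let criterion = schurIdentity⇔ K t ζ char0 ζ-primitive λ₂≤λ₁ in mk⇔
      (λ identity → Sum.map (Equivalence.from (twoRow-core t λ₁ λ₂ λ₂≤λ₁)) exceptional⇐ (Equivalence.to criterion identity))
      (λ cases → Equivalence.from criterion (Sum.map (Equivalence.to (twoRow-core t λ₁ λ₂ λ₂≤λ₁)) exceptional⇒ cases)))
  , λ exceptional →
    let u , j , t≡u+u , j<u , λ₂≡u+j , suc-λ₁ = exceptional⇒ exceptional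
        open Exception t t≡u+u j<u λ₂≡u+j suc-λ₁
        t/2≡u = u+u/2 u t≡u+u
    in (P , isPairs , differences , ε≡1) ,
       subst₂ (λ h k → core t (λ₁ ∷ λ₂ ∷ []) ≋ (h ∸ 1 + k ∷ k ∷ [])
           × quotient t (λ₁ ∷ λ₂ ∷ []) k ≋ (2 ∷ [])
           × (∀ i → i < t → i ≢ k → quotient t (λ₁ ∷ λ₂ ∷ []) i ≋ []))
         (sym t/2≡u) (sym (trans (cong₂ _∸_ λ₂≡u+j t/2≡u) (m+n∸m≡n u j)))
         (core≋ , quotient-j , quotient-other)
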